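{- Let $q$ be a power of a prime $p$, let $\mathcal{T}$ be a multiset of points of $\mathrm{AG}(2,q)$, let $\lambda$ be an integer, and let $\mathcal{F}_\lambda$ be a set of $(q-\lambda)$-uniform directions w.r.t. $\mathcal{T}$. For each $(d)\in\mathcal{F}_\lambda$ denote the typical intersection number by $m_d$, and denote the intersection numbers with $\mathcal{T}$ of the renitent lines with slope $d$ by $t_{d,1},t_{d,2},\ldots,t_{d,\lambda_d}$, for some $0<\lambda_d\le\lambda$ (one entry for each renitent line with slope $d$). For $c\in\mathbb{F}_p\setminus\{0\}$ define the integers $\lambda_{d,i}(c)\in\{1,\ldots,p-1\}$ by $$c\,\lambda_{d,i}(c)\equiv t_{d,i}-m_d \pmod p,$$ and assume that (the sum being taken over natural numbers) $$\Lambda_d(c):=\sum_{i=1}^{\lambda_d}\lambda_{d,i}(c)\le \min\{q-2,p-1\}$$ holds for each $(d)\in\mathcal{F}_\lambda$. Then $\Lambda(c):=\Lambda_d(c)$ does not depend on $d$, and the renitent lines with direction in $\mathcal{F}_\lambda$ are contained in an algebraic envelope of class $\Lambda(c)$ such that: if $\ell$ is a renitent line with slope $d$, $(d)\in\mathcal{F}_\lambda$, and with intersection number $t_{d,i}$, then the intersection multiplicity of the pencil centered at $(d)$ with this envelope at $\ell$ is $\lambda_{d,i}(c)$.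
   Context: $\mathrm{AG}(2,q)$ is the desarguesian affine plane over $\mathbb{F}_q$, embedded in $\mathrm{PG}(2,q)$ as the set of points $(a:b:1)$; the line at infinity is $\ell_\infty=[0:0:1]$. Here $[u:v:w]$ denotes the line $\{(x:y:z): ux+vy+wz=0\}$. The points of $\ell_\infty$ are called directions: $(d)=(1:d:0)$ for $d\in\mathbb{F}_q$ and $(\infty)=(0:1:0)$. The affine lines with slope (direction) $d$ are the $q$ affine lines through $(d)$. Multisets are finite, and intersection sizes with $\mathcal{T}$ are counted with multiplicity. A direction $(d)$ is $(q-\lambda)$-uniform w.r.t. $\mathcal{T}$ if at least $q-\lambda$ affine lines with slope $d$ meet $\mathcal{T}$ in the same number of points modulo $p$; this number (modulo $p$) is the typical intersection number at $(d)$. If it is not uniquely determined, one such number is fixed for $(d)$. The other affine lines with slope $d$ (those whose intersection size with $\mathcal{T}$ is not congruent to the typical intersection number modulo $p$) are called renitent. An algebraic envelope of class $n$ is a curve of degree $n$ in the dual plane, i.e. it is given by a nonzero homogeneous polynomial $g\in\mathbb{F}_q[U,V,W]$ of degree $n$; a line $[u:v:w]$ is contained in it if $g(u,v,w)=0$. The pencil centered at a point $P=(x:y:z)$ is the set of lines through $P$; it is the line $xU+yV+zW=0$ of the dual plane. The intersection multiplicity of a pencil with an envelope at a line $\ell$ is the usual intersection multiplicity, in the dual plane, of this line $xU+yV+zW=0$ and the curve $g=0$ at the point of the dual plane corresponding to $\ell$, i.e. the multiplicity of that point as a zero of the restriction of $g$ to the line $xU+yV+zW=0$. -}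

module Defs where

open import Level using (Level; _⊔_) renaming (suc to lsuc)
open import Algebra.Bundles using (CommutativeRing; Semiring; RawSemiring)
import Algebra.Definitions as AlgDefs
import Algebra.Definitions.RawSemiring as RawSemiringDefs
open import Data.Nat.Base using (ℕ; zero; suc; _∸_; _<_; +-0-rawMonoid)
open import Data.Integer.Base as ℤ using (ℤ; +_)
open import Data.Integer.Divisibility using (_∣_)
open import Data.Fin.Base using (Fin; toℕ)
import Data.Fin.Properties as Fin
open import Data.List.Base as List using (List; []; _∷_; length; filter)
open import Data.Product.Base using (Σ; ∃; _×_; _,_)
open import Function.Bundles using (Inverse)
open import Function.Definitions using (Injective)
open import Function.Properties.Inverse using (Inverse⇒Injection)
import Function.Construct.Symmetry as Symmetry
open import Relation.Binary.Core using (Rel)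
open import Relation.Binary.Definitions using (Decidable)
open import Relation.Binary.PropositionalEquality as ≡ using (_≡_)
open import Relation.Nullary.Decidable using (via-injection)
open import Relation.Nullary.Negation using (¬_)
open import Relation.Unary using (Pred)

open import Algebra.Definitions.RawMonoid +-0-rawMonoid public
  using () renaming (sum to sumℕ)

infix 4 _≡_[mod_]

_≡_[mod_] : ℤ → ℤ → ℕ → Set
a ≡ b [mod p ] = + p ∣ (a ℤ.- b)

record FiniteField (a ℓ : Level) (q : ℕ) : Set (lsuc (a ⊔ ℓ)) where
  field
    commutativeRing : CommutativeRing a ℓ
  open CommutativeRing commutativeRing public
  open AlgDefs _≈_ using (Invertible)
  field
    1≉0        : ¬ 1# ≈ 0#
    invertible : ∀ x → ¬ x ≈ 0# → Invertible 1# _*_ x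
    enumeration : Inverse (≡.setoid (Fin q)) setoid

  infix 4 _≟_
  _≟_ : Decidable _≈_
  _≟_ = via-injection (Inverse⇒Injection (Symmetry.inverse enumeration)) Fin._≟_

module Plane {a ℓ : Level} {q : ℕ} (𝔽 : FiniteField a ℓ q) where
  open FiniteField 𝔽 renaming (Carrier to F)

  -- Points and lines of PG(2,q) are both given by homogeneous coordinates,
  -- so that a line is literally a point of the dual plane.
  record Homogeneous : Set (a ⊔ ℓ) where
    constructor mk
    field
      c₁ c₂ c₃ : F
      nonzero  : ¬ (c₁ ≈ 0# × c₂ ≈ 0# × c₃ ≈ 0#)
  open Homogeneous

  Point Line : Set (a ⊔ ℓ)
  Point = Homogeneous
  Line  = Homogeneous

  infix 4 _∼_
  _∼_ : Rel Homogeneous (a ⊔ ℓ)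
  x ∼ y = Σ F λ k → ¬ k ≈ 0# × c₁ y ≈ k * c₁ x × c₂ y ≈ k * c₂ x × c₃ y ≈ k * c₃ x

  infix 4 _∈ₗ_ _∈ₗ?_
  _∈ₗ_ : Point → Line → Set ℓ
  P ∈ₗ l = c₁ l * c₁ P + c₂ l * c₂ P + c₃ l * c₃ P ≈ 0#

  _∈ₗ?_ : Decidable _∈ₗ_
  P ∈ₗ? l = (c₁ l * c₁ P + c₂ l * c₂ P + c₃ l * c₃ P) ≟ 0#

  ℓ∞ : Line
  ℓ∞ = mk 0# 0# 1# λ (_ , _ , e) → 1≉0 e

  AffinePoint : Set a
  AffinePoint = F × F

  embed : AffinePoint → Point
  embed (x , y) = mk x y 1# λ (_ , _ , e) → 1≉0 e

  data Direction : Set a where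
    slope : F → Direction
    ∞     : Direction

  ⟨_⟩ : Direction → Point
  ⟨ slope d ⟩ = mk 1# d 0# λ (e , _ , _) → 1≉0 e
  ⟨ ∞ ⟩       = mk 0# 1# 0# λ (_ , e , _) → 1≉0 e

  HasSlope : Direction → Pred Line (a ⊔ ℓ)
  HasSlope d l = ⟨ d ⟩ ∈ₗ l × ¬ l ∼ ℓ∞

  -- A finite multiset is a list; nothing below depends on the order.
  Multiset : Set a
  Multiset = List AffinePoint

  #_∩_ : Line → Multiset → ℕ
  # l ∩ T = length (filter (λ P → embed P ∈ₗ? l) T)

  AtLeast : ∀ {r} → ℤ → Pred Line r → Set (a ⊔ ℓ ⊔ r)
  AtLeast n Q = Σ ℕ λ k → n ℤ.≤ + k × Σ (Fin k → Line) λ f →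
    Injective _≡_ _∼_ f × (∀ i → Q (f i))

  Enumerates : ∀ {r} {k : ℕ} → (Fin k → Line) → Pred Line r → Set (a ⊔ ℓ ⊔ r)
  Enumerates f Q =
    (∀ i → Q (f i)) × Injective _≡_ _∼_ f × (∀ l → Q l → ∃ λ i → f i ∼ l)

  -- The direction is (q-lam)-uniform with typical intersection number m mod p.
  IsTypical : (p : ℕ) (T : Multiset) (lam : ℤ) (d : Direction) (m : ℤ) → Set (a ⊔ ℓ)
  IsTypical p T lam d m =
    AtLeast (+ q ℤ.- lam) λ l → HasSlope d l × + (# l ∩ T) ≡ m [mod p ]

  Renitent : (p : ℕ) (T : Multiset) (d : Direction) (m : ℤ) → Pred Line (a ⊔ ℓ)
  Renitent p T d m l = HasSlope d l × ¬ (+ (# l ∩ T) ≡ m [mod p ])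

  Poly : Set a
  Poly = List F

  coeff : Poly → ℕ → F
  coeff []       _       = 0#
  coeff (x ∷ _)  zero    = x
  coeff (_ ∷ xs) (suc n) = coeff xs n

  infixl 6 _+ₚ_
  infixl 7 _*ₚ_
  _+ₚ_ : Poly → Poly → Poly
  []       +ₚ ys       = ys
  (x ∷ xs) +ₚ []       = x ∷ xs
  (x ∷ xs) +ₚ (y ∷ ys) = (x + y) ∷ (xs +ₚ ys)

  _*ₚ_ : Poly → Poly → Poly
  []       *ₚ ys = []
  (x ∷ xs) *ₚ ys = List.map (x *_) ys +ₚ (0# ∷ xs *ₚ ys)

  constant : F → Poly
  constant x = x ∷ []

  polyRawSemiring : RawSemiring a ℓ
  polyRawSemiring = record
    { Carrier = Poly
    ; _≈_     = λ f g → ∀ n → coeff f n ≈ coeff g n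
    ; _+_     = _+ₚ_
    ; _*_     = _*ₚ_
    ; 0#      = []
    ; 1#      = constant 1#
    }

  HasOrderAt0 : Poly → ℕ → Set ℓ
  HasOrderAt0 f k = (∀ i → i < k → coeff f i ≈ 0#) × ¬ coeff f k ≈ 0#

  -- A homogeneous polynomial of degree n in U, V, W: the entry at i, j is the
  -- coefficient of U^j V^(i-j) W^(n-i), where j ≤ i ≤ n.
  Form : ℕ → Set a
  Form n = (i : Fin (suc n)) → Fin (suc (toℕ i)) → F

  NonzeroForm : ∀ {n} → Form n → Set ℓ
  NonzeroForm g = ∃ λ i → ∃ λ j → ¬ g i j ≈ 0#

  module _ {b m} (A : RawSemiring b m) (ι : F → RawSemiring.Carrier A) where
    private module A = RawSemiring A
    open RawSemiringDefs A using (sum; _^_)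

    evalIn : ∀ {n} → Form n → A.Carrier → A.Carrier → A.Carrier → A.Carrier
    evalIn {n} g u v w = sum λ i → sum λ j →
      ι (g i j) A.* (u ^ toℕ j A.* v ^ (toℕ i ∸ toℕ j) A.* w ^ (n ∸ toℕ i))

  _∈ₑ_ : ∀ {n} → Line → Form n → Set ℓ
  l ∈ₑ g = evalIn (Semiring.rawSemiring semiring) (λ x → x) g (c₁ l) (c₂ l) (c₃ l) ≈ 0#

  -- g(l + t l′) as a polynomial in t: for l ≁ l′ this is the restriction of g to
  -- the line of the dual plane joining l and l′, in the affine chart with
  -- parameter t in which the point l is t = 0.
  restrict : ∀ {n} → Form n → Line → Line → Poly
  restrict g l l′ = evalIn polyRawSemiring constant g
    (c₁ l ∷ c₁ l′ ∷ []) (c₂ l ∷ c₂ l′ ∷ []) (c₃ l ∷ c₃ l′ ∷ [])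

  -- The pencil centred at P and the envelope g meet at l with multiplicity k.
  -- The multiplicity does not depend on the second line l′ of the pencil used to
  -- parametrise it, so it is required for every choice.
  PencilMultiplicity : ∀ {n} → Point → Form n → Line → ℕ → Set (a ⊔ ℓ)
  PencilMultiplicity P g l k =
    P ∈ₗ l × (∀ l′ → P ∈ₗ l′ → ¬ l ∼ l′ → HasOrderAt0 (restrict g l l′) k)

-- Let c⁻¹ be a natural number inverse to c modulo p, and let T/c be T with every
-- point taken c⁻¹ times.  Fix a direction d and the linear form ρX + τY whose level
-- sets are the affine lines of slope d.  In 𝔽, the number of points of T/c at level x
-- is a constant independent of x, plus λ_{d,i} if that level is the i-th renitent
-- line, at level α_{d,i} say.  As Σ_x x^k = 0 for 0 ≤ k ≤ q − 2, the values of the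
-- form on T/c and the α_{d,i}, each taken λ_{d,i} times, have equal power sums of
-- these orders.  Order 0 gives Λ_d ≡ |T/c| modulo p, which determines Λ_d; by Newton's
-- identities, where only integers below p are cancelled, the elementary symmetric
-- functions of order ≤ Λ agree too.  Those of the forms Ux + Vy, (x , y) ∈ T/c, are
-- forms e_k(U , V), and Σ_k e_k(U , V) W^(Λ-k) becomes Π_i (W + α_{d,i} S)^λ_{d,i} on
-- the pencil U = ρS, V = τS.  Neither Λ nor this envelope refers to 𝓕, so it does not
-- matter that 𝓕 may be undecidable.
module Submission where

open import Defs
open import Level using (Level)
open import Algebra.Bundles using (CommutativeMonoid; CommutativeRing; CommutativeSemiring; Semiring)
open import Algebra.Morphism.Structures using (IsSemiringHomomorphism)
open import Algebra.Structures.Biased using (isCommutativeMonoidˡ; isCommutativeSemiringˡ)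
open import Data.Nat.Base as ℕ using (ℕ; zero; suc; _∸_; _≤_; _<_; _⊓_; z≤n; s≤s; NonZero)
import Data.Nat.Properties as ℕ
import Data.Nat.Divisibility as ℕ
open import Data.Nat.Coprimality using (Coprime; coprime-Bézout)
open import Data.Nat.DivMod using (_%_; _/_; m≡m%n+[m/n]*n; m%n<n)
open import Data.Nat.GCD using (module Bézout)
open import Data.Nat.Primality using (Prime; prime⇒irreducible; prime⇒nonZero)
open import Data.Integer.Base as ℤ using (ℤ; +_)
import Data.Integer.Properties as ℤ
open import Data.Integer.Divisibility using (_∣_)
import Data.Integer.Divisibility.Signed as Signed
open import Data.Integer.DivMod using (_%ℕ_; _/ℕ_; a≡a%ℕn+[a/ℕn]*n)
import Data.Integer.Tactic.RingSolver as ℤ-RingSolver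
open import Data.Fin.Base as Fin using (Fin; zero; suc; toℕ)
import Data.Fin.Properties as Fin
open import Data.Fin.Permutation using (Permutation; permutation)
open import Data.Vec.Base as Vec using (Vec; []; _∷_)
open import Data.List.Base using (List; []; _∷_; length; map; _++_; replicate; filter; concatMap)
open import Data.List.Properties using
  ( filter-accept; filter-reject; filter-all; filter-none; filter-++; filter-≐
  ; length-map; length-replicate; length-++; map-++; map-replicate; map-id)
open import Data.List.Relation.Unary.All using (All; []; _∷_)
open import Data.List.Relation.Unary.All.Properties using (replicate⁺; ++⁺)
open import Data.Product.Base using (Σ; ∃; _×_; _,_; proj₁; proj₂)
open import Data.Sum.Base using (inj₁; inj₂)
open import Function.Base using (_∘_)
open import Function.Bundles using (Inverse)
open import Relation.Binary.PropositionalEquality as ≡ using (_≡_; _≢_)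
open import Relation.Binary.Structures using (IsEquivalence)
open import Relation.Nullary.Decidable using (Dec; yes; no; ¬?; decidable-stable)
open import Relation.Nullary.Negation using (¬_; contradiction)
open import Relation.Unary using (Pred; _∈_)
import Algebra.Morphism.Construct.Identity as Identity
import Algebra.Properties.CommutativeMonoid.Mult as CommutativeMult
import Algebra.Properties.CommutativeMonoid.Sum as CommutativeMonoidSum
import Algebra.Properties.CommutativeSemiring.Exp as CommutativeExp
import Algebra.Properties.Ring as RingProperties
import Algebra.Properties.Semiring.Exp as Exp
import Algebra.Properties.Semiring.Mult as Mult
import Algebra.Properties.Semiring.Sum as SemiringSum
import Algebra.Solver.Ring.NaturalCoefficients.Default as SemiringSolver
import Relation.Binary.Reasoning.Setoid as SetoidReasoning

-- Lying in the envelope and meeting a pencil with a given multiplicity both concern values of one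
-- form: in 𝔽 for the former, in 𝔽[t] for the latter. The factorisation on a pencil is therefore
-- proved once, over any commutative semiring that receives a homomorphism from 𝔽. A semiring is
-- enough because the factors are written w + x s, without signs; the signs are left to Newton's
-- identities, which are used over 𝔽 only. The envelope is a truncation. `T/c` may have far more
-- than Λ points, and the power sums control only its elementary symmetric functions of order at
-- most Λ; these are exactly the ones that a form of degree Λ has room for. The list of the α_{d,i}
-- has length Λ, so on the pencil nothing is cut off and the truncated form is a full product of Λ
-- linear factors.

module SumOverSupport {a ℓ : Level} (M : CommutativeMonoid a ℓ) where
  open CommutativeMonoid M
  open CommutativeMonoidSum M

  sum-zero : ∀ {n} (t : Fin n → Carrier) → (∀ i → t i ≈ ε) → sum t ≈ ε
  sum-zero {n} t t≈ε = trans (sum-cong-≋ t≈ε) (sum-replicate-zero n)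

  sum-single : ∀ {n} (t : Fin n → Carrier) i → (∀ j → j ≢ i → t j ≈ ε) → sum t ≈ t i
  sum-single t zero    others =
    trans (∙-congˡ (sum-zero (t ∘ suc) λ j → others (suc j) λ ())) (identityʳ _)
  sum-single t (suc i) others =
    trans (∙-cong (others zero λ ())
                  (sum-single (t ∘ suc) i λ j j≢i → others (suc j) (j≢i ∘ Fin.suc-injective)))
          (identityˡ _)

-- Elementary symmetric functions and binary forms.

module ElementarySymmetric {a ℓ : Level} (A : CommutativeSemiring a ℓ) where
  open CommutativeSemiring A hiding (zero) renaming (Carrier to C)
  open SemiringSum semiring
  open Exp semiring
  open SetoidReasoning setoid
  private module S = SemiringSolver A

  -- The k-th elementary symmetric function of the entries: a choice of k entries either omits the
  -- head or contains it.
  e : List C → ℕ → C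
  e _       zero    = 1#
  e []      (suc k) = 0#
  e (x ∷ L) (suc k) = e L (suc k) + x * e L k

  e-vanishes : ∀ L {k} → length L < k → e L k ≈ 0#
  e-vanishes []      (s≤s _)   = refl
  e-vanishes (x ∷ L) {suc k} (s≤s L<k) = begin
    e L (suc k) + x * e L k ≈⟨ +-cong (e-vanishes L (ℕ.m<n⇒m<1+n L<k)) (*-congˡ (e-vanishes L L<k)) ⟩
    0# + x * 0#             ≈⟨ trans (+-identityˡ _) (zeroʳ x) ⟩
    0#                      ∎

  -- The generating polynomial of `e L`, homogenised because on a pencil both `s` and `w` vary,
  -- linearly in the parameter t.
  product-of : List C → C → C → C
  product-of []      s w = 1#
  product-of (x ∷ L) s w = (w + x * s) * product-of L s w

  product-of-++ : ∀ L M s w → product-of (L ++ M) s w ≈ product-of L s w * product-of M s w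
  product-of-++ []      M s w = sym (*-identityˡ _)
  product-of-++ (x ∷ L) M s w = trans (*-congˡ (product-of-++ L M s w)) (sym (*-assoc _ _ _))

  monomial : ∀ k → C → C → Fin (suc k) → C
  monomial k u v j = u ^ toℕ j * v ^ (k ∸ toℕ j)

  terms : ∀ k → (ℕ → C) → C → C → Fin (suc k) → C
  terms k f u v j = f (toℕ j) * monomial k u v j

  -- The coefficients form a sequence on all of ℕ, so that they can be shifted and added without
  -- changing the index type; entries beyond `k` are ignored.
  binary : ℕ → (ℕ → C) → C → C → C
  binary k f u v = sum (terms k f u v)

  binary-cong : ∀ k {f g : ℕ → C} u v → (∀ {j} → j ≤ k → f j ≈ g j) → binary k f u v ≈ binary k g u v
  binary-cong k {f} {g} u v f≈g = sum-cong-≋ {x = terms k f u v} {terms k g u v} 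
    λ j → *-congʳ {monomial k u v j} (f≈g (ℕ.≤-pred (Fin.toℕ<n j)))

  times-u : (ℕ → C) → ℕ → C
  times-u f zero    = 0#
  times-u f (suc j) = f j

  binary-suc : ∀ k f u v → binary (suc k) f u v ≈ f 0 * v ^ suc k + u * binary k (f ∘ suc) u v
  binary-suc k f u v = +-cong (*-congˡ (*-identityˡ _)) (begin
    sum (terms (suc k) f u v ∘ suc)
      ≈⟨ sum-cong-≋ {x = terms (suc k) f u v ∘ suc} {λ j → u * terms k (f ∘ suc) u v j} (λ j → S.solve 4 (λ f u x y → f S.:* (u S.:* x S.:* y)
           S.:= u S.:* (f S.:* (x S.:* y)))
           refl (f (suc (toℕ j))) u (u ^ toℕ j) (v ^ (k ∸ toℕ j))) ⟩
    sum (λ j → u * terms k (f ∘ suc) u v j)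
      ≈⟨ *-distribˡ-sum u (terms k (f ∘ suc) u v) ⟨
    u * binary k (f ∘ suc) u v ∎)

  binary-times-u : ∀ k f u v → binary (suc k) (times-u f) u v ≈ u * binary k f u v
  binary-times-u k f u v = trans (binary-suc k (times-u f) u v)
    (trans (+-congʳ (zeroˡ _)) (+-identityˡ _))

  -- Multiplication by `v` keeps every coefficient in its place. In degree k + 1 the entry
  -- `f (suc k)` would add the new monomial u^(k+1), which is not a multiple of `v`, so this entry
  -- has to vanish.
  binary-times-v : ∀ k f u v → f (suc k) ≈ 0# → binary (suc k) f u v ≈ v * binary k f u v
  binary-times-v zero f u v f₁≈0 = begin
    binary 1 f u v ≈⟨ +-congˡ (+-congʳ (*-congʳ f₁≈0)) ⟩
    f 0 * (1# * (v * 1#)) + (0# * (u * 1# * 1#) + 0#)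
      ≈⟨ S.solve 3 (λ f u v → f S.:* (S.con 1 S.:* (v S.:* S.con 1)) S.:+ (S.con 0 S.:* (u S.:* S.con 1 S.:* S.con 1) S.:+ S.con 0)
           S.:= v S.:* (f S.:* (S.con 1 S.:* S.con 1) S.:+ S.con 0)) refl (f 0) u v ⟩
    v * (f 0 * (1# * 1#) + 0#) ∎
  binary-times-v (suc k) f u v fₖ≈0 = begin
    binary (suc (suc k)) f u v
      ≈⟨ binary-suc (suc k) f u v ⟩
    f 0 * v ^ suc (suc k) + u * binary (suc k) (f ∘ suc) u v
      ≈⟨ +-congˡ (*-congˡ (binary-times-v k (f ∘ suc) u v fₖ≈0)) ⟩
    f 0 * (v * v ^ suc k) + u * (v * binary k (f ∘ suc) u v)
      ≈⟨ S.solve 5 (λ f v w u b → f S.:* (v S.:* w) S.:+ u S.:* (v S.:* b) S.:= v S.:* (f S.:* w S.:+ u S.:* b))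
           refl (f 0) v (v ^ suc k) u (binary k (f ∘ suc) u v) ⟩
    v * (f 0 * v ^ suc k + u * binary k (f ∘ suc) u v)
      ≈⟨ *-congˡ (binary-suc k f u v) ⟨
    v * binary (suc k) f u v ∎

  binary-times-linear : ∀ k f x y u v → f (suc k) ≈ 0# →
    binary (suc k) (λ j → x * times-u f j + y * f j) u v ≈ (x * u + y * v) * binary k f u v
  binary-times-linear k f x y u v fₖ≈0 = begin
    binary (suc k) (λ j → x * times-u f j + y * f j) u v
      ≈⟨ sum-cong-≋ {x = terms (suc k) (λ j → x * times-u f j + y * f j) u v} {λ j → x * t₁ j + y * t₂ j} (λ j →
           S.solve 5 (λ x y f g m → (x S.:* f S.:+ y S.:* g) S.:* m S.:= x S.:* (f S.:* m) S.:+ y S.:* (g S.:* m))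
             refl x y (times-u f (toℕ j)) (f (toℕ j)) (monomial (suc k) u v j)) ⟩
    sum (λ j → x * t₁ j + y * t₂ j)
      ≈⟨ ∑-distrib-+ (λ j → x * t₁ j) (λ j → y * t₂ j) ⟩
    sum (λ j → x * t₁ j) + sum (λ j → y * t₂ j)
      ≈⟨ +-cong (*-distribˡ-sum x t₁) (*-distribˡ-sum y t₂) ⟨
    x * binary (suc k) (times-u f) u v + y * binary (suc k) f u v
      ≈⟨ +-cong (*-congˡ (binary-times-u k f u v)) (*-congˡ (binary-times-v k f u v fₖ≈0)) ⟩
    x * (u * binary k f u v) + y * (v * binary k f u v)
      ≈⟨ S.solve 5 (λ x u y v b → x S.:* (u S.:* b) S.:+ y S.:* (v S.:* b) S.:= (x S.:* u S.:+ y S.:* v) S.:* b)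
           refl x u y v (binary k f u v) ⟩
    (x * u + y * v) * binary k f u v ∎
    where
    t₁ t₂ : Fin (suc (suc k)) → C
    t₁ = terms (suc k) (times-u f) u v
    t₂ = terms (suc k) f u v

  binary-+ : ∀ k f g u v → binary k (λ j → f j + g j) u v ≈ binary k f u v + binary k g u v
  binary-+ k f g u v = trans
    (sum-cong-≋ {x = terms k (λ j → f j + g j) u v} {λ j → terms k f u v j + terms k g u v j}
      λ j → distribʳ (monomial k u v j) (f (toℕ j)) (g (toℕ j)))
    (∑-distrib-+ (terms k f u v) (terms k g u v))

  -- Vieta's formulas: the recursion of `e` is multiplication of the coefficient sequence by w + x
  -- s, and `e-vanishes` supplies the zero above the top degree.
  binary-e : ∀ L s w → binary (length L) (e L) s w ≈ product-of L s w
  binary-e []      s w = S.solve 0 (S.con 1 S.:* (S.con 1 S.:* S.con 1) S.:+ S.con 0 S.:= S.con 1) refl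
  binary-e (x ∷ L) s w = begin
    binary (suc n) (e (x ∷ L)) s w
      ≈⟨ binary-cong (suc n) s w (λ {j} _ → expand j) ⟩
    binary (suc n) (λ j → x * times-u (e L) j + 1# * e L j) s w
      ≈⟨ binary-times-linear n (e L) x 1# s w (e-vanishes L ℕ.≤-refl) ⟩
    (x * s + 1# * w) * binary n (e L) s w
      ≈⟨ *-cong (S.solve 3 (λ x s w → x S.:* s S.:+ S.con 1 S.:* w S.:= w S.:+ x S.:* s)
           refl x s w) (binary-e L s w) ⟩
    (w + x * s) * product-of L s w ∎
    where
    n = length L
    expand : ∀ j → e (x ∷ L) j ≈ x * times-u (e L) j + 1# * e L j
    expand zero    = S.solve 1 (λ x → S.con 1 S.:= x S.:* S.con 0 S.:+ S.con 1 S.:* S.con 1) refl x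
    expand (suc j) = S.solve 3 (λ x a b → a S.:+ x S.:* b S.:= x S.:* b S.:+ S.con 1 S.:* a)
         refl x (e L (suc j)) (e L j)

  -- e-form L k j is the coefficient of U^j V^(k-j) in the k-th elementary
  -- symmetric function of the linear forms xU + yV, (x , y) ∈ L.
  e-form : List (C × C) → ℕ → ℕ → C
  e-form _             zero    zero    = 1#
  e-form _             zero    (suc j) = 0#
  e-form []            (suc k) j       = 0#
  e-form ((x , y) ∷ L) (suc k) j       =
    e-form L (suc k) j + (x * times-u (e-form L k) j + y * e-form L k j)

  e-form-vanishes : ∀ L {k j} → k < j → e-form L k j ≈ 0#
  e-form-vanishes _             {zero}  {suc j} _         = refl
  e-form-vanishes []            {suc k} {suc j} _         = refl
  e-form-vanishes ((x , y) ∷ L) {suc k} {suc j} (s≤s k<j) = begin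
    e-form L (suc k) (suc j) + (x * e-form L k j + y * e-form L k (suc j))
      ≈⟨ +-cong (e-form-vanishes L (s≤s k<j))
          (+-cong (*-congˡ (e-form-vanishes L k<j)) (*-congˡ (e-form-vanishes L (ℕ.m<n⇒m<1+n k<j)))) ⟩
    0# + (x * 0# + y * 0#)
      ≈⟨ S.solve 2 (λ x y → S.con 0 S.:+ (x S.:* S.con 0 S.:+ y S.:* S.con 0) S.:= S.con 0) refl x y ⟩
    0# ∎

  linear : C → C → C × C → C
  linear u v (x , y) = x * u + y * v

  -- The recursion of `e-form` is that of `e` with multiplication by an entry replaced by
  -- multiplication by the form xU + yV, so evaluation at (u , v) carries one into the other.
  binary-e-form : ∀ L k u v → binary k (e-form L k) u v ≈ e (map (linear u v) L) k
  binary-e-form _  zero u v = S.solve 0 (S.con 1 S.:* (S.con 1 S.:* S.con 1) S.:+ S.con 0 S.:= S.con 1) refl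
  binary-e-form [] (suc k) u v =
    SumOverSupport.sum-zero +-commutativeMonoid (terms (suc k) (e-form [] (suc k)) u v)
      λ j → zeroˡ (monomial (suc k) u v j)
  binary-e-form (P@(x , y) ∷ L) (suc k) u v = begin
    binary (suc k) (e-form (P ∷ L) (suc k)) u v
      ≈⟨ binary-+ (suc k) (e-form L (suc k)) (λ j → x * times-u (e-form L k) j + y * e-form L k j) u v ⟩
    binary (suc k) (e-form L (suc k)) u v + binary (suc k) (λ j → x * times-u (e-form L k) j + y * e-form L k j) u v
      ≈⟨ +-cong (binary-e-form L (suc k) u v)
          (binary-times-linear k (e-form L k) x y u v (e-form-vanishes L {k} ℕ.≤-refl)) ⟩
    e (map (linear u v) L) (suc k) + (x * u + y * v) * binary k (e-form L k) u v
      ≈⟨ +-congˡ (*-congˡ (binary-e-form L k u v)) ⟩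
    e (map (linear u v) (P ∷ L)) (suc k) ∎

-- The envelope on a pencil, over an extension of the field.

module Extension {a ℓ b₁ b₂ : Level} {q : ℕ} (𝔽 : FiniteField a ℓ q) (A : CommutativeSemiring b₁ b₂)
  (ι : FiniteField.Carrier 𝔽 → CommutativeSemiring.Carrier A)
  (ι-hom : IsSemiringHomomorphism (Semiring.rawSemiring (FiniteField.semiring 𝔽)) (CommutativeSemiring.rawSemiring A) ι)
  where
  private
    module K where
      open FiniteField 𝔽 public
      open SemiringSum semiring public
      open Exp semiring public
      open ElementarySymmetric commutativeSemiring public
  open CommutativeSemiring A
  open SemiringSum semiring
  open Exp semiring
  open CommutativeExp A using (^-distrib-*)
  open ElementarySymmetric A
  private module S = SemiringSolver A
  open IsSemiringHomomorphism ι-hom using (⟦⟧-cong; +-homo; *-homo; 0#-homo; 1#-homo)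
  open SetoidReasoning setoid

  ι-sum : ∀ {n} (t : Fin n → K.Carrier) → ι (K.sum t) ≈ sum (ι ∘ t)
  ι-sum {zero}  t = 0#-homo
  ι-sum {suc n} t = trans (+-homo _ _) (+-congˡ (ι-sum (t ∘ suc)))

  ι-^ : ∀ x n → ι (x K.^ n) ≈ ι x ^ n
  ι-^ x zero    = 1#-homo
  ι-^ x (suc n) = trans (*-homo _ _) (*-congˡ (ι-^ x n))

  ι-e : ∀ L k → ι (K.e L k) ≈ e (map ι L) k
  ι-e _       zero    = 1#-homo
  ι-e []      (suc k) = 0#-homo
  ι-e (x ∷ L) (suc k) =
    trans (+-homo _ _) (+-cong (ι-e L (suc k)) (trans (*-homo _ _) (*-congˡ (ι-e L k))))

  form-terms : ∀ n → (ℕ → ℕ → K.Carrier) → Carrier → Carrier → Carrier → (i : ℕ) → Fin (suc i) → Carrier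
  form-terms n G u v w i j = ι (G i (toℕ j)) * (u ^ toℕ j * v ^ (i ∸ toℕ j) * w ^ (n ∸ i))

  form : ∀ n → (ℕ → ℕ → K.Carrier) → Plane.Form 𝔽 n
  form n G i j = G (toℕ i) (toℕ j)

  form-value : ∀ n → (ℕ → ℕ → K.Carrier) → Carrier → Carrier → Carrier → Carrier
  form-value n G u v w = Plane.evalIn 𝔽 (CommutativeSemiring.rawSemiring A) ι (form n G) u v w

  collapse-term : ∀ i j ρ τ s → j ≤ i →
    (ι ρ * s) ^ j * (ι τ * s) ^ (i ∸ j) ≈ ι (ρ K.^ j K.* τ K.^ (i ∸ j)) * s ^ i
  collapse-term i j ρ τ s j≤i = begin
    (ι ρ * s) ^ j * (ι τ * s) ^ (i ∸ j)
      ≈⟨ *-cong (^-distrib-* (ι ρ) s j) (^-distrib-* (ι τ) s (i ∸ j)) ⟩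
    (ι ρ ^ j * s ^ j) * (ι τ ^ (i ∸ j) * s ^ (i ∸ j))
      ≈⟨ S.solve 4 (λ a b c d → (a S.:* b) S.:* (c S.:* d) S.:= (a S.:* c) S.:* (b S.:* d)) refl
           (ι ρ ^ j) (s ^ j) (ι τ ^ (i ∸ j)) (s ^ (i ∸ j)) ⟩
    (ι ρ ^ j * ι τ ^ (i ∸ j)) * (s ^ j * s ^ (i ∸ j))
      ≈⟨ *-cong (trans (*-homo _ _) (*-cong (ι-^ ρ j) (ι-^ τ (i ∸ j)))) (^-homo-* s j (i ∸ j)) ⟨
    ι (ρ K.^ j K.* τ K.^ (i ∸ j)) * s ^ (j ℕ.+ (i ∸ j))
      ≡⟨ ≡.cong (λ k → ι (ρ K.^ j K.* τ K.^ (i ∸ j)) * s ^ k) (ℕ.m+[n∸m]≡n j≤i) ⟩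
    ι (ρ K.^ j K.* τ K.^ (i ∸ j)) * s ^ i ∎

  -- The part of degree i in U and V is homogeneous, so at (ρ s , τ s) it is its value at (ρ , τ), a
  -- scalar of 𝔽, times s^i.
  collapse-inner : ∀ n G i ρ τ {u v} s w → u ≈ ι ρ * s → v ≈ ι τ * s →
    sum (form-terms n G u v w i) ≈ ι (K.binary i (G i) ρ τ) * (s ^ i * w ^ (n ∸ i))
  collapse-inner n G i ρ τ {u} {v} s w u≈ v≈ = begin
    sum (form-terms n G u v w i)
      ≈⟨ sum-cong-≋ {x = form-terms n G u v w i} {λ j → ι (K.terms i (G i) ρ τ j) * m} term ⟩
    sum (λ j → ι (K.terms i (G i) ρ τ j) * m)
      ≈⟨ *-distribʳ-sum m (ι ∘ K.terms i (G i) ρ τ) ⟨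
    sum (ι ∘ K.terms i (G i) ρ τ) * m
      ≈⟨ *-congʳ (ι-sum (K.terms i (G i) ρ τ)) ⟨
    ι (K.binary i (G i) ρ τ) * m ∎
    where
    m = s ^ i * w ^ (n ∸ i)
    term : ∀ j → form-terms n G u v w i j ≈ ι (K.terms i (G i) ρ τ j) * m
    term j = begin
      ι (G i (toℕ j)) * (u ^ toℕ j * v ^ (i ∸ toℕ j) * w ^ (n ∸ i))
        ≈⟨ *-congˡ (*-congʳ (*-cong (^-congˡ (toℕ j) u≈) (^-congˡ (i ∸ toℕ j) v≈))) ⟩
      ι (G i (toℕ j)) * ((ι ρ * s) ^ toℕ j * (ι τ * s) ^ (i ∸ toℕ j) * w ^ (n ∸ i))
        ≈⟨ *-congˡ (*-congʳ (collapse-term i (toℕ j) ρ τ s (ℕ.≤-pred (Fin.toℕ<n j)))) ⟩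
      ι (G i (toℕ j)) * (ι (K.monomial i ρ τ j) * s ^ i * w ^ (n ∸ i))
        ≈⟨ trans (*-congˡ (*-assoc _ _ _)) (sym (*-assoc _ _ _)) ⟩
      ι (G i (toℕ j)) * ι (K.monomial i ρ τ j) * m
        ≈⟨ *-congʳ (*-homo _ _) ⟨
      ι (K.terms i (G i) ρ τ j) * m ∎

  form-value-on-pencil : ∀ n G ρ τ {u v} s w → u ≈ ι ρ * s → v ≈ ι τ * s →
    form-value n G u v w ≈ binary n (λ i → ι (K.binary i (G i) ρ τ)) s w
  form-value-on-pencil n G ρ τ {u} {v} s w u≈ v≈ =
    sum-cong-≋ {x = λ i → sum (form-terms n G u v w (toℕ i))}
               {terms n (λ i → ι (K.binary i (G i) ρ τ)) s w}
               (λ i → collapse-inner n G (toℕ i) ρ τ s w u≈ v≈)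

  -- On the pencil the coefficient of s^i is e_i of the values ρx + τy, which may be replaced by e_i
  -- of `M` for i ≤ n. As `M` has exactly n entries, the sum is then the whole product over `M`; `L`
  -- may be longer, since its later symmetric functions do not enter.
  form-value-factors : ∀ {n} L M → length M ≡ n → ∀ ρ τ {u v} s w → u ≈ ι ρ * s → v ≈ ι τ * s →
    (∀ {k} → k ≤ n → K.e (map (K.linear ρ τ) L) k K.≈ K.e M k) →
    form-value n (K.e-form L) u v w ≈ product-of (map ι M) s w
  form-value-factors {n} L M ≡.refl ρ τ {u} {v} s w u≈ v≈ same-e = begin
    form-value n (K.e-form L) u v w
      ≈⟨ form-value-on-pencil n (K.e-form L) ρ τ s w u≈ v≈ ⟩
    binary n (λ i → ι (K.binary i (K.e-form L i) ρ τ)) s w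
      ≈⟨ binary-cong n s w (λ {i} i≤n →
           trans (⟦⟧-cong (K.trans (K.binary-e-form L i ρ τ) (same-e i≤n))) (ι-e M i)) ⟩
    binary n (e (map ι M)) s w
      ≡⟨ ≡.cong (λ k → binary k (e (map ι M)) s w) (length-map ι M) ⟨
    binary (length (map ι M)) (e (map ι M)) s w
      ≈⟨ binary-e (map ι M) s w ⟩
    product-of (map ι M) s w ∎

-- Newton's identities.

module Newton {a ℓ : Level} (R : CommutativeRing a ℓ) where
  open CommutativeRing R hiding (zero) renaming (Carrier to C)
  open ElementarySymmetric commutativeSemiring
  open Exp semiring
  open Mult semiring renaming (_×_ to _·_)
  open CommutativeMult +-commutativeMonoid using (×-distrib-+)
  open SetoidReasoning setoid
  private module S = SemiringSolver commutativeSemiring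

  sum-over : List C → (C → C) → C
  sum-over []      f = 0#
  sum-over (x ∷ L) f = f x + sum-over L f

  -- (-1)^k x^(k+1): the signs of Newton's identities are absorbed here.
  power : ℕ → C → C
  power k x = x * (- x) ^ k

  -- The Cauchy product, the sum of f (k - j) g j over j ≤ k. The recursion shifts `g`, which avoids
  -- subtracting indices.
  convolve : (ℕ → C) → (ℕ → C) → ℕ → C
  convolve f g zero    = f 0 * g 0
  convolve f g (suc k) = f (suc k) * g 0 + convolve f (g ∘ suc) k

  convolve-cong : ∀ k {f f′ g g′ : ℕ → C} → (∀ {j} → j ≤ k → f j ≈ f′ j) → (∀ {j} → j ≤ k → g j ≈ g′ j) →
    convolve f g k ≈ convolve f′ g′ k
  convolve-cong zero    f≈ g≈ = *-cong (f≈ z≤n) (g≈ z≤n)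
  convolve-cong (suc k) f≈ g≈ = +-cong (*-cong (f≈ ℕ.≤-refl) (g≈ z≤n))
    (convolve-cong k (f≈ ∘ ℕ.m≤n⇒m≤1+n) (g≈ ∘ s≤s))

  convolve-+ʳ : ∀ k f g h → convolve f (λ j → g j + h j) k ≈ convolve f g k + convolve f h k
  convolve-+ʳ zero    f g h = distribˡ _ _ _
  convolve-+ʳ (suc k) f g h = trans (+-cong (distribˡ _ _ _) (convolve-+ʳ k f (g ∘ suc) (h ∘ suc)))
    (S.solve 4 (λ a b c d → (a S.:+ b) S.:+ (c S.:+ d) S.:= (a S.:+ c) S.:+ (b S.:+ d)) refl _ _ _ _)

  convolve-*ʳ : ∀ k f x g → convolve f (λ j → x * g j) k ≈ x * convolve f g k
  convolve-*ʳ zero    f x g = S.solve 3 (λ f x g → f S.:* (x S.:* g) S.:= x S.:* (f S.:* g)) refl _ _ _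
  convolve-*ʳ (suc k) f x g = trans (+-congˡ (convolve-*ʳ k f x (g ∘ suc)))
    (S.solve 4 (λ f x g c → f S.:* (x S.:* g) S.:+ x S.:* c S.:= x S.:* (f S.:* g S.:+ c)) refl _ _ _ _)

  convolve-zeroʳ : ∀ k f → convolve f (λ _ → 0#) k ≈ 0#
  convolve-zeroʳ zero    f = zeroʳ _
  convolve-zeroʳ (suc k) f = trans (+-cong (zeroʳ _) (convolve-zeroʳ k f)) (+-identityˡ _)

  -- A new head multiplies the generating function of `e` by 1 + x t. The index is `suc k` because
  -- the constant term has no x-part.
  convolve-e-∷ : ∀ k x L g → convolve (e (x ∷ L)) g (suc k) ≈ convolve (e L) g (suc k) + x * convolve (e L) g k
  convolve-e-∷ zero    x L g = S.solve 5 (λ x e₁ e₀ g₀ g₁ →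
    (e₁ S.:+ x S.:* e₀) S.:* g₀ S.:+ e₀ S.:* g₁ S.:= (e₁ S.:* g₀ S.:+ e₀ S.:* g₁) S.:+ x S.:* (e₀ S.:* g₀))
    refl x (e L 1) 1# (g 0) (g 1)
  convolve-e-∷ (suc k) x L g = trans (+-congˡ (convolve-e-∷ k x L (g ∘ suc)))
    (S.solve 6 (λ x e₂ e₁ g₀ c d →
      (e₂ S.:+ x S.:* e₁) S.:* g₀ S.:+ (c S.:+ x S.:* d) S.:= (e₂ S.:* g₀ S.:+ c) S.:+ x S.:* (e₁ S.:* g₀ S.:+ d))
    refl x (e L (suc (suc k))) (e L (suc k)) (g 0) _ _)

  -- The generating function of `power j x` is x / (1 + x t), whose denominator cancels the factor 1
  -- + x t that the head contributes.
  convolve-powers-of-head : ∀ k x L → convolve (e (x ∷ L)) (λ j → power j x) k ≈ x * e L k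
  convolve-powers-of-head zero    x L = *-identityˡ _
  convolve-powers-of-head (suc k) x L = begin
    e (x ∷ L) (suc k) * power 0 x + convolve (e (x ∷ L)) (λ j → power (suc j) x) k
      ≈⟨ +-congˡ (convolve-cong k {f = e (x ∷ L)} (λ _ → refl) (λ {j} _ →
           S.solve 3 (λ x y z → x S.:* (y S.:* z) S.:= y S.:* (x S.:* z)) refl x (- x) ((- x) ^ j))) ⟩
    e (x ∷ L) (suc k) * power 0 x + convolve (e (x ∷ L)) (λ j → - x * power j x) k
      ≈⟨ +-congˡ (trans (convolve-*ʳ k (e (x ∷ L)) (- x) (λ j → power j x)) (*-congˡ (convolve-powers-of-head k x L))) ⟩
    (e L (suc k) + x * e L k) * (x * 1#) + - x * (x * e L k)
      ≈⟨ S.solve 4 (λ x y a b → (a S.:+ x S.:* b) S.:* (x S.:* S.con 1) S.:+ y S.:* (x S.:* b)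
           S.:= x S.:* a S.:+ (x S.:+ y) S.:* (x S.:* b)) refl x (- x) (e L (suc k)) (e L k) ⟩
    x * e L (suc k) + (x + - x) * (x * e L k)
      ≈⟨ +-congˡ (trans (*-congʳ (-‿inverseʳ x)) (zeroˡ _)) ⟩
    x * e L (suc k) + 0#
      ≈⟨ +-identityʳ _ ⟩
    x * e L (suc k) ∎

  -- The coefficient of t^k in E′ = E · Σ x / (1 + x t), the logarithmic derivative of E = Π (1 + x
  -- t).
  newton : ∀ k L → convolve (e L) (λ j → sum-over L (power j)) k ≈ suc k · e L (suc k)
  newton k [] = begin
    convolve (e []) (λ _ → 0#) k ≈⟨ convolve-zeroʳ k (e []) ⟩
    0#                           ≈⟨ zeroʳ (suc k · 1#) ⟨
    suc k · 1# * 0#              ≈⟨ ×-assoc-* (suc k) 1# 0# ⟩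
    suc k · (1# * 0#)            ≈⟨ ×-congʳ (suc k) (*-identityˡ 0#) ⟩
    suc k · 0#                   ∎
  newton k (x ∷ L) = begin
    convolve (e (x ∷ L)) (λ j → power j x + p j) k
      ≈⟨ convolve-+ʳ k (e (x ∷ L)) (λ j → power j x) p ⟩
    convolve (e (x ∷ L)) (λ j → power j x) k + convolve (e (x ∷ L)) p k
      ≈⟨ +-cong (convolve-powers-of-head k x L) (tail-part k) ⟩
    -- The head gives one copy of x e_k and the tail gives k more, which makes up the required
    -- factor k + 1.
    x * e L k + (suc k · e L (suc k) + x * (k · e L k))
      ≈⟨ +-congˡ (+-congˡ (×-comm-* k x (e L k))) ⟩
    x * e L k + (suc k · e L (suc k) + k · (x * e L k))
      ≈⟨ S.solve 3 (λ a b c → a S.:+ (b S.:+ c) S.:= b S.:+ (a S.:+ c)) refl _ _ _ ⟩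
    suc k · e L (suc k) + suc k · (x * e L k)
      ≈⟨ ×-distrib-+ _ _ (suc k) ⟨
    suc k · e (x ∷ L) (suc k) ∎
    where
    p : ℕ → C
    p j = sum-over L (power j)

    tail-part : ∀ k → convolve (e (x ∷ L)) p k ≈ suc k · e L (suc k) + x * (k · e L k)
    tail-part zero    = trans (newton 0 L) (sym (trans (+-congˡ (zeroʳ x)) (+-identityʳ _)))
    tail-part (suc k) = trans (convolve-e-∷ k x L p) (+-cong (newton (suc k) L) (*-congˡ (newton k L)))

  power-sums-determine-e : ∀ n L M →
    (∀ {k} → k < n → ∀ {x y} → suc k · x ≈ suc k · y → x ≈ y) →
    (∀ {k} → k < n → sum-over L (power k) ≈ sum-over M (power k)) →
    ∀ {k} → k ≤ n → e L k ≈ e M k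
  power-sums-determine-e n L M cancel same {k} k≤n = up-to k k≤n ℕ.≤-refl
    where
    -- Newton's identity for e_(k+1) involves all earlier e_j, so the induction carries all of them.
    up-to : ∀ k → k ≤ n → ∀ {j} → j ≤ k → e L j ≈ e M j
    up-to k k≤n {zero} _ = refl
    up-to (suc k) k<n {suc j} (s≤s j≤k) = cancel (ℕ.≤-trans (s≤s j≤k) k<n) (begin
      suc j · e L (suc j)                                ≈⟨ newton j L ⟨
      convolve (e L) (λ i → sum-over L (power i)) j
        ≈⟨ convolve-cong j (λ i≤j → up-to k (ℕ.<⇒≤ k<n) (ℕ.≤-trans i≤j j≤k))
             (λ i≤j → same (ℕ.≤-trans (s≤s (ℕ.≤-trans i≤j j≤k)) k<n)) ⟩
      convolve (e M) (λ i → sum-over M (power i)) j      ≈⟨ newton j M ⟩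
      suc j · e M (suc j)                                ∎)

-- Cancellation in a field.

module FieldProperties {a ℓ : Level} {q : ℕ} (𝔽 : FiniteField a ℓ q) where
  open FiniteField 𝔽 hiding (zero) renaming (Carrier to F)
  open RingProperties ring
  open SetoidReasoning setoid

  cancel-nonzero : ∀ {x y} → ¬ x ≈ 0# → x * y ≈ 0# → y ≈ 0#
  cancel-nonzero {x} {y} x≉0 xy≈0 with invertible x x≉0
  ... | x⁻¹ , x⁻¹x≈1 , _ = begin
    y             ≈⟨ *-identityˡ y ⟨
    1# * y        ≈⟨ *-congʳ x⁻¹x≈1 ⟨
    x⁻¹ * x * y   ≈⟨ *-assoc x⁻¹ x y ⟩
    x⁻¹ * (x * y) ≈⟨ *-congˡ xy≈0 ⟩
    x⁻¹ * 0#      ≈⟨ zeroʳ x⁻¹ ⟩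
    0#            ∎

  *-cancelˡ-nonzero : ∀ {x y z} → ¬ x ≈ 0# → x * y ≈ x * z → y ≈ z
  *-cancelˡ-nonzero {x} {y} {z} x≉0 xy≈xz = x∙y⁻¹≈ε⇒x≈y y z (cancel-nonzero x≉0 (begin
    x * (y + - z)     ≈⟨ distribˡ x y (- z) ⟩
    x * y + x * - z   ≈⟨ +-cong xy≈xz (sym (-‿distribʳ-* x z)) ⟩
    x * z + - (x * z) ≈⟨ -‿inverseʳ (x * z) ⟩
    0#                ∎))

  *-cancelʳ-nonzero : ∀ {x y z} → ¬ x ≈ 0# → y * x ≈ z * x → y ≈ z
  *-cancelʳ-nonzero x≉0 yx≈zx =
    *-cancelˡ-nonzero x≉0 (trans (*-comm _ _) (trans yx≈zx (*-comm _ _)))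

-- Polynomials in one variable and their order at 0.

module Polynomials {a ℓ : Level} {q : ℕ} (𝔽 : FiniteField a ℓ q) where
  open FiniteField 𝔽 hiding (zero) renaming (Carrier to F)
  open Plane 𝔽
  open FieldProperties 𝔽
  open RingProperties ring using (+-cancelˡ)
  open SetoidReasoning setoid
  private module S = SemiringSolver commutativeSemiring

  infix 4 _≈ₚ_
  -- Coefficientwise, because lists that differ by trailing zeros are the same polynomial.
  _≈ₚ_ : Poly → Poly → Set ℓ
  f ≈ₚ g = ∀ n → coeff f n ≈ coeff g n

  scale : F → Poly → Poly
  scale x = map (x *_)

  coeff-+ : ∀ f g n → coeff (f +ₚ g) n ≈ coeff f n + coeff g n
  coeff-+ []      g       n       = sym (+-identityˡ _)
  coeff-+ (x ∷ f) []      n       = sym (+-identityʳ _)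
  coeff-+ (x ∷ f) (y ∷ g) zero    = refl
  coeff-+ (x ∷ f) (y ∷ g) (suc n) = coeff-+ f g n

  coeff-scale : ∀ x f n → coeff (scale x f) n ≈ x * coeff f n
  coeff-scale x []      n       = sym (zeroʳ x)
  coeff-scale x (y ∷ f) zero    = refl
  coeff-scale x (y ∷ f) (suc n) = coeff-scale x f n

  coeff-* : ∀ x f g n → coeff ((x ∷ f) *ₚ g) n ≈ x * coeff g n + coeff (0# ∷ f *ₚ g) n
  coeff-* x f g n = trans (coeff-+ (scale x g) (0# ∷ f *ₚ g) n) (+-congʳ (coeff-scale x g n))

  ∷-cong : ∀ {x f g} → f ≈ₚ g → (x ∷ f) ≈ₚ (x ∷ g)
  ∷-cong f≈g zero    = refl
  ∷-cong f≈g (suc n) = f≈g n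

  +ₚ-cong : ∀ {f f′ g g′} → f ≈ₚ f′ → g ≈ₚ g′ → f +ₚ g ≈ₚ f′ +ₚ g′
  +ₚ-cong {f} {f′} {g} {g′} f≈ g≈ n =
    trans (coeff-+ f g n) (trans (+-cong (f≈ n) (g≈ n)) (sym (coeff-+ f′ g′ n)))

  +ₚ-assoc : ∀ f g h → (f +ₚ g) +ₚ h ≈ₚ f +ₚ (g +ₚ h)
  +ₚ-assoc f g h n = begin
    coeff ((f +ₚ g) +ₚ h) n               ≈⟨ trans (coeff-+ (f +ₚ g) h n) (+-congʳ (coeff-+ f g n)) ⟩
    (coeff f n + coeff g n) + coeff h n   ≈⟨ +-assoc _ _ _ ⟩
    coeff f n + (coeff g n + coeff h n)   ≈⟨ trans (coeff-+ f (g +ₚ h) n) (+-congˡ (coeff-+ g h n)) ⟨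
    coeff (f +ₚ (g +ₚ h)) n               ∎

  +ₚ-comm : ∀ f g → f +ₚ g ≈ₚ g +ₚ f
  +ₚ-comm f g n = trans (coeff-+ f g n) (trans (+-comm _ _) (sym (coeff-+ g f n)))

  *ₚ-congˡ : ∀ f {g h} → g ≈ₚ h → f *ₚ g ≈ₚ f *ₚ h
  *ₚ-congˡ []      g≈h n = refl
  *ₚ-congˡ (x ∷ f) {g} {h} g≈h n = begin
    coeff ((x ∷ f) *ₚ g) n                    ≈⟨ coeff-* x f g n ⟩
    x * coeff g n + coeff (0# ∷ f *ₚ g) n     ≈⟨ +-cong (*-congˡ (g≈h n)) (∷-cong (*ₚ-congˡ f g≈h) n) ⟩
    x * coeff h n + coeff (0# ∷ f *ₚ h) n     ≈⟨ coeff-* x f h n ⟨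
    coeff ((x ∷ f) *ₚ h) n                    ∎

  *ₚ-zeroʳ : ∀ f → f *ₚ [] ≈ₚ []
  *ₚ-zeroʳ []      n       = refl
  *ₚ-zeroʳ (x ∷ f) zero    = refl
  *ₚ-zeroʳ (x ∷ f) (suc n) = *ₚ-zeroʳ f n

  -- The mirror image of the recursion defining `_*ₚ_`, which consumes the left factor;
  -- commutativity rests on it.
  *ₚ-∷ : ∀ f y g → f *ₚ (y ∷ g) ≈ₚ scale y f +ₚ (0# ∷ f *ₚ g)
  *ₚ-∷ []      y g zero    = refl
  *ₚ-∷ []      y g (suc n) = refl
  *ₚ-∷ (x ∷ f) y g zero    = +-congʳ (*-comm x y)
  *ₚ-∷ (x ∷ f) y g (suc n) = begin
    coeff (scale x g +ₚ f *ₚ (y ∷ g)) n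
      ≈⟨ coeff-+ (scale x g) (f *ₚ (y ∷ g)) n ⟩
    coeff (scale x g) n + coeff (f *ₚ (y ∷ g)) n
      ≈⟨ +-cong (coeff-scale x g n) (trans (*ₚ-∷ f y g n) (coeff-+ (scale y f) (0# ∷ f *ₚ g) n)) ⟩
    x * coeff g n + (coeff (scale y f) n + coeff (0# ∷ f *ₚ g) n)
      ≈⟨ S.solve 3 (λ a b c → a S.:+ (b S.:+ c) S.:= b S.:+ (a S.:+ c)) refl _ _ _ ⟩
    coeff (scale y f) n + (x * coeff g n + coeff (0# ∷ f *ₚ g) n)
      ≈⟨ trans (coeff-+ (scale y f) ((x ∷ f) *ₚ g) n) (+-congˡ (coeff-* x f g n)) ⟨
    coeff (scale y f +ₚ (x ∷ f) *ₚ g) n ∎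

  *ₚ-comm : ∀ f g → f *ₚ g ≈ₚ g *ₚ f
  *ₚ-comm []      g n = sym (*ₚ-zeroʳ g n)
  *ₚ-comm (x ∷ f) g n = trans
    (+ₚ-cong {scale x g} {scale x g} {0# ∷ f *ₚ g} {0# ∷ g *ₚ f} (λ _ → refl)
        (∷-cong {f = f *ₚ g} {g *ₚ f} (*ₚ-comm f g)) n)
    (sym (*ₚ-∷ g x f n))

  -- Equal left factors can be lists of different lengths, which would upset an induction along
  -- them; commutativity moves them to the right.
  *ₚ-cong : ∀ {f f′ g g′} → f ≈ₚ f′ → g ≈ₚ g′ → f *ₚ g ≈ₚ f′ *ₚ g′
  *ₚ-cong {f} {f′} {g} {g′} f≈ g≈ n = begin
    coeff (f *ₚ g) n   ≈⟨ *ₚ-congˡ f g≈ n ⟩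
    coeff (f *ₚ g′) n  ≈⟨ *ₚ-comm f g′ n ⟩
    coeff (g′ *ₚ f) n  ≈⟨ *ₚ-congˡ g′ f≈ n ⟩
    coeff (g′ *ₚ f′) n ≈⟨ *ₚ-comm g′ f′ n ⟩
    coeff (f′ *ₚ g′) n ∎

  ∷-+ : ∀ f g → (0# ∷ f +ₚ g) ≈ₚ (0# ∷ f) +ₚ (0# ∷ g)
  ∷-+ f g zero    = sym (+-identityˡ 0#)
  ∷-+ f g (suc n) = refl

  *ₚ-distribˡ : ∀ f g h → f *ₚ (g +ₚ h) ≈ₚ f *ₚ g +ₚ f *ₚ h
  *ₚ-distribˡ []      g h n = refl
  *ₚ-distribˡ (x ∷ f) g h n = begin
    coeff ((x ∷ f) *ₚ (g +ₚ h)) n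
      ≈⟨ coeff-* x f (g +ₚ h) n ⟩
    x * coeff (g +ₚ h) n + coeff (0# ∷ f *ₚ (g +ₚ h)) n
      ≈⟨ +-cong (*-congˡ (coeff-+ g h n)) (begin
           coeff (0# ∷ f *ₚ (g +ₚ h)) n           ≈⟨ ∷-cong (*ₚ-distribˡ f g h) n ⟩
           coeff (0# ∷ (f *ₚ g +ₚ f *ₚ h)) n      ≈⟨ ∷-+ (f *ₚ g) (f *ₚ h) n ⟩
           coeff ((0# ∷ f *ₚ g) +ₚ (0# ∷ f *ₚ h)) n ≈⟨ coeff-+ (0# ∷ f *ₚ g) (0# ∷ f *ₚ h) n ⟩
           coeff (0# ∷ f *ₚ g) n + coeff (0# ∷ f *ₚ h) n ∎) ⟩
    x * (coeff g n + coeff h n) + (coeff (0# ∷ f *ₚ g) n + coeff (0# ∷ f *ₚ h) n)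
      ≈⟨ S.solve 5 (λ x g h c d → x S.:* (g S.:+ h) S.:+ (c S.:+ d)
           S.:= (x S.:* g S.:+ c) S.:+ (x S.:* h S.:+ d))
           refl x _ _ _ _ ⟩
    (x * coeff g n + coeff (0# ∷ f *ₚ g) n) + (x * coeff h n + coeff (0# ∷ f *ₚ h) n)
      ≈⟨ +-cong (coeff-* x f g n) (coeff-* x f h n) ⟨
    coeff ((x ∷ f) *ₚ g) n + coeff ((x ∷ f) *ₚ h) n
      ≈⟨ coeff-+ ((x ∷ f) *ₚ g) ((x ∷ f) *ₚ h) n ⟨
    coeff ((x ∷ f) *ₚ g +ₚ (x ∷ f) *ₚ h) n ∎

  *ₚ-distribʳ : ∀ f g h → (g +ₚ h) *ₚ f ≈ₚ g *ₚ f +ₚ h *ₚ f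
  *ₚ-distribʳ f g h n = begin
    coeff ((g +ₚ h) *ₚ f) n     ≈⟨ *ₚ-comm (g +ₚ h) f n ⟩
    coeff (f *ₚ (g +ₚ h)) n     ≈⟨ *ₚ-distribˡ f g h n ⟩
    coeff (f *ₚ g +ₚ f *ₚ h) n  ≈⟨ +ₚ-cong {f *ₚ g} {g *ₚ f} {f *ₚ h} {h *ₚ f} (*ₚ-comm f g) (*ₚ-comm f h) n ⟩
    coeff (g *ₚ f +ₚ h *ₚ f) n  ∎

  scale-* : ∀ x f g → scale x f *ₚ g ≈ₚ scale x (f *ₚ g)
  scale-* x []      g n = refl
  scale-* x (y ∷ f) g n = begin
    coeff (scale x (y ∷ f) *ₚ g) n
      ≈⟨ coeff-* (x * y) (scale x f) g n ⟩
    x * y * coeff g n + coeff (0# ∷ scale x f *ₚ g) n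
      ≈⟨ +-congˡ (shifted n) ⟩
    x * y * coeff g n + x * coeff (0# ∷ f *ₚ g) n
      ≈⟨ S.solve 4 (λ x y g c → x S.:* y S.:* g S.:+ x S.:* c S.:= x S.:* (y S.:* g S.:+ c)) refl x y _ _ ⟩
    x * (y * coeff g n + coeff (0# ∷ f *ₚ g) n)
      ≈⟨ *-congˡ (coeff-* y f g n) ⟨
    x * coeff ((y ∷ f) *ₚ g) n
      ≈⟨ coeff-scale x ((y ∷ f) *ₚ g) n ⟨
    coeff (scale x ((y ∷ f) *ₚ g)) n ∎
    where
    shifted : ∀ n → coeff (0# ∷ scale x f *ₚ g) n ≈ x * coeff (0# ∷ f *ₚ g) n
    shifted zero    = sym (zeroʳ x)
    shifted (suc n) = trans (scale-* x f g n) (coeff-scale x (f *ₚ g) n)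

  0∷-* : ∀ f g → (0# ∷ f) *ₚ g ≈ₚ (0# ∷ f *ₚ g)
  0∷-* f g n = trans (coeff-* 0# f g n) (trans (+-congʳ (zeroˡ _)) (+-identityˡ _))

  *ₚ-assoc : ∀ f g h → (f *ₚ g) *ₚ h ≈ₚ f *ₚ (g *ₚ h)
  *ₚ-assoc []      g h n = refl
  *ₚ-assoc (x ∷ f) g h n = begin
    coeff ((scale x g +ₚ (0# ∷ f *ₚ g)) *ₚ h) n
      ≈⟨ *ₚ-distribʳ h (scale x g) (0# ∷ f *ₚ g) n ⟩
    coeff (scale x g *ₚ h +ₚ (0# ∷ f *ₚ g) *ₚ h) n
      ≈⟨ +ₚ-cong {scale x g *ₚ h} {scale x (g *ₚ h)} {(0# ∷ f *ₚ g) *ₚ h} {0# ∷ f *ₚ (g *ₚ h)} (scale-* x g h)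
           (λ k → trans (0∷-* (f *ₚ g) h k) (∷-cong {f = f *ₚ g *ₚ h} {f *ₚ (g *ₚ h)} (*ₚ-assoc f g h) k)) n ⟩
    coeff (scale x (g *ₚ h) +ₚ (0# ∷ f *ₚ (g *ₚ h))) n ∎

  *ₚ-identityˡ : ∀ f → constant 1# *ₚ f ≈ₚ f
  *ₚ-identityˡ f zero    = trans (coeff-* 1# [] f 0) (trans (+-identityʳ _) (*-identityˡ _))
  *ₚ-identityˡ f (suc n) = trans (coeff-* 1# [] f (suc n)) (trans (+-identityʳ _) (*-identityˡ _))

  ≈ₚ-isEquivalence : IsEquivalence _≈ₚ_
  ≈ₚ-isEquivalence = record
    { refl  = λ _ → refl
    ; sym   = λ f≈g n → sym (f≈g n)
    ; trans = λ f≈g g≈h n → trans (f≈g n) (g≈h n)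
    }

  polySemiring : CommutativeSemiring a ℓ
  polySemiring = record
    { Carrier = Poly
    ; _≈_     = _≈ₚ_
    ; _+_     = _+ₚ_
    ; _*_     = _*ₚ_
    ; 0#      = []
    ; 1#      = constant 1#
    ; isCommutativeSemiring = isCommutativeSemiringˡ record
      { +-isCommutativeMonoid = isCommutativeMonoidˡ record
        { isSemigroup = record
          { isMagma = record { isEquivalence = ≈ₚ-isEquivalence ; ∙-cong = λ {f} {f′} {g} {g′} → +ₚ-cong {f} {f′} {g} {g′} }
          ; assoc   = +ₚ-assoc
          }
        ; identityˡ = λ _ _ → refl
        ; comm      = +ₚ-comm
        }
      ; *-isCommutativeMonoid = isCommutativeMonoidˡ record
        { isSemigroup = record
          { isMagma = record { isEquivalence = ≈ₚ-isEquivalence ; ∙-cong = λ {f} {f′} {g} {g′} → *ₚ-cong {f} {f′} {g} {g′} }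
          ; assoc   = *ₚ-assoc
          }
        ; identityˡ = *ₚ-identityˡ
        ; comm      = *ₚ-comm
        }
      ; distribʳ = *ₚ-distribʳ
      ; zeroˡ    = λ _ _ → refl
      }
    }

  open ElementarySymmetric polySemiring using (product-of)

  constant-cong : ∀ {x y} → x ≈ y → constant x ≈ₚ constant y
  constant-cong x≈y zero    = x≈y
  constant-cong x≈y (suc n) = refl

  constant-isSemiringHomomorphism :
    IsSemiringHomomorphism (Semiring.rawSemiring semiring) (CommutativeSemiring.rawSemiring polySemiring) constant
  constant-isSemiringHomomorphism = record
    { isNearSemiringHomomorphism = record
      { +-isMonoidHomomorphism = record
        { isMagmaHomomorphism = record
          { isRelHomomorphism = record { cong = constant-cong }
          ; homo              = λ _ _ _ → refl
          }
        ; ε-homo = λ { zero → refl ; (suc n) → refl }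
        }
      ; *-homo = λ { x y zero → sym (+-identityʳ _) ; x y (suc n) → refl }
      }
    ; 1#-homo = λ _ → refl
    }

  order-cong : ∀ {f g k} → f ≈ₚ g → HasOrderAt0 g k → HasOrderAt0 f k
  order-cong {k = k} f≈g (g-vanishes , gₖ≉0) =
    (λ i i<k → trans (f≈g i) (g-vanishes i i<k)) , λ fₖ≈0 → gₖ≉0 (trans (sym (f≈g k)) fₖ≈0)

  coeff-linear-zero : ∀ x y f → coeff ((x ∷ y ∷ []) *ₚ f) 0 ≈ x * coeff f 0
  coeff-linear-zero x y f = trans (coeff-* x (y ∷ []) f 0) (+-identityʳ _)

  coeff-linear-suc : ∀ x y f n → coeff ((x ∷ y ∷ []) *ₚ f) (suc n) ≈ x * coeff f (suc n) + y * coeff f n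
  coeff-linear-suc x y f n = begin
    coeff ((x ∷ y ∷ []) *ₚ f) (suc n)                       ≈⟨ coeff-* x (y ∷ []) f (suc n) ⟩
    x * coeff f (suc n) + coeff (constant y *ₚ f) n         ≈⟨ +-congˡ (coeff-* y [] f n) ⟩
    x * coeff f (suc n) + (y * coeff f n + coeff (0# ∷ []) n) ≈⟨ +-congˡ (trans (+-congˡ (0∷[] n)) (+-identityʳ _)) ⟩
    x * coeff f (suc n) + y * coeff f n                     ∎
    where
    0∷[] : ∀ n → coeff (0# ∷ []) n ≈ 0#
    0∷[] zero    = refl
    0∷[] (suc n) = refl

  -- Up to degree k the term with `y` sees only coefficients of `f` below degree k, all zero, so
  -- there the product is `x` times `f`.
  order-*-unit : ∀ {x y f k} → ¬ x ≈ 0# → HasOrderAt0 f k → HasOrderAt0 ((x ∷ y ∷ []) *ₚ f) k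
  order-*-unit {x} {y} {f} {k} x≉0 (f-vanishes , fₖ≉0) =
    (λ i i<k → trans (low i (ℕ.<⇒≤ i<k)) (trans (*-congˡ (f-vanishes i i<k)) (zeroʳ x))) ,
    λ gₖ≈0 → fₖ≉0 (cancel-nonzero x≉0 (trans (sym (low k ℕ.≤-refl)) gₖ≈0))
    where
    low : ∀ i → i ≤ k → coeff ((x ∷ y ∷ []) *ₚ f) i ≈ x * coeff f i
    low zero    _   = coeff-linear-zero x y f
    low (suc i) i<k = trans (coeff-linear-suc x y f i)
      (trans (+-congˡ (trans (*-congˡ (f-vanishes i i<k)) (zeroʳ y))) (+-identityʳ _))

  order-*-uniformizer : ∀ {x y f k} → x ≈ 0# → ¬ y ≈ 0# → HasOrderAt0 f k → HasOrderAt0 ((x ∷ y ∷ []) *ₚ f) (suc k)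
  order-*-uniformizer {x} {y} {f} {k} x≈0 y≉0 (f-vanishes , fₖ≉0) = vanishes ,
    λ gₖ≈0 → fₖ≉0 (cancel-nonzero y≉0 (trans (sym (shifted k)) gₖ≈0))
    where
    shifted : ∀ i → coeff ((x ∷ y ∷ []) *ₚ f) (suc i) ≈ y * coeff f i
    shifted i = trans (coeff-linear-suc x y f i)
      (trans (+-congʳ (trans (*-congʳ x≈0) (zeroˡ _))) (+-identityˡ _))
    vanishes : ∀ i → i < suc k → coeff ((x ∷ y ∷ []) *ₚ f) i ≈ 0#
    vanishes zero    _         = trans (coeff-linear-zero x y f) (trans (*-congʳ x≈0) (zeroˡ _))
    vanishes (suc i) (s≤s i<k) = trans (shifted i) (trans (*-congˡ (f-vanishes i i<k)) (zeroʳ y))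

  -- The entry x contributes the factor (w + x s) + (w′ + x s′) t. Since s ≠ 0 and w + γ s = 0, its
  -- constant term vanishes exactly for x = γ, and then its coefficient of t is nonzero: each
  -- occurrence of γ raises the order by one and other entries leave it unchanged.
  order-product : ∀ γ s s′ w w′ → ¬ s ≈ 0# → w + γ * s ≈ 0# → ¬ w′ + γ * s′ ≈ 0# → ∀ L →
    HasOrderAt0 (product-of (map constant L) (s ∷ s′ ∷ []) (w ∷ w′ ∷ [])) (length (filter (_≟ γ) L))
  order-product γ s s′ w w′ s≉0 vanishes simple [] = (λ i ()) , 1≉0
  order-product γ s s′ w w′ s≉0 vanishes simple (x ∷ L) =
    step (x ≟ γ) (order-product γ s s′ w w′ s≉0 vanishes simple L)
    where
    HasOrder : List F → ℕ → Set ℓ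
    HasOrder L = HasOrderAt0 (product-of (map constant L) (s ∷ s′ ∷ []) (w ∷ w′ ∷ []))
    f : Poly
    f = product-of (map constant L) (s ∷ s′ ∷ []) (w ∷ w′ ∷ [])
    step : Dec (x ≈ γ) → HasOrder L (length (filter (_≟ γ) L)) →
           HasOrder (x ∷ L) (length (filter (_≟ γ) (x ∷ L)))
    step (yes x≈γ) rest =
      ≡.subst (HasOrder (x ∷ L)) (≡.cong length (≡.sym (filter-accept (_≟ γ) x≈γ)))
        (order-*-uniformizer {f = f}
          (trans (+-congˡ (trans (+-identityʳ _) (*-congʳ x≈γ))) vanishes)
          (λ e → simple (trans (+-congˡ (*-congʳ (sym x≈γ))) e)) rest)
    step (no x≉γ) rest =
      ≡.subst (HasOrder (x ∷ L)) (≡.cong length (≡.sym (filter-reject (_≟ γ) x≉γ)))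
        (order-*-unit {f = f} (λ e → x≉γ (*-cancelʳ-nonzero s≉0
          (+-cancelˡ w (x * s) (γ * s) (trans (trans (+-congˡ (sym (+-identityʳ _))) e) (sym vanishes))))) rest)

-- Sums over all elements of the field.

module FiniteFieldSums {a ℓ : Level} {q : ℕ} (𝔽 : FiniteField a ℓ q) where
  open FiniteField 𝔽 hiding (zero) renaming (Carrier to F)
  open FieldProperties 𝔽
  open SemiringSum semiring
  open Exp semiring
  open Mult semiring renaming (_×_ to _·_)
  open CommutativeExp commutativeSemiring using (^-distrib-*)
  open Newton commutativeRing
  open SumOverSupport +-commutativeMonoid
  open RingProperties ring
  open SetoidReasoning setoid
  private module S = SemiringSolver commutativeSemiring

  element : Fin q → F
  element = Inverse.to enumeration

  index : F → Fin q
  index = Inverse.from enumeration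

  element-index : ∀ x → element (index x) ≈ x
  element-index x = Inverse.strictlyInverseˡ enumeration x

  index-unique : ∀ {i x} → element i ≈ x → i ≡ index x
  index-unique {i} i≈x = ≡.trans (≡.sym (Inverse.strictlyInverseʳ enumeration i))
      (Inverse.from-cong enumeration i≈x)

  total : (F → F) → F
  total f = sum (f ∘ element)

  total-cong : ∀ {f g : F → F} → (∀ x → f x ≈ g x) → total f ≈ total g
  total-cong f≈g = sum-cong-≋ (f≈g ∘ element)

  total-reindex : ∀ (f φ ψ : F → F) →
    (∀ {x y} → x ≈ y → f x ≈ f y) → (∀ {x y} → x ≈ y → φ x ≈ φ y) → (∀ {x y} → x ≈ y → ψ x ≈ ψ y) →
    (∀ x → φ (ψ x) ≈ x) → (∀ x → ψ (φ x) ≈ x) → total f ≈ total (f ∘ φ)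
  total-reindex f φ ψ f-cong φ-cong ψ-cong φψ ψφ =
    trans (sum-permute (f ∘ element) π) (sum-cong-≋ λ i → f-cong (element-index (φ (element i))))
    where
    conjugate : (F → F) → Fin q → Fin q
    conjugate χ = index ∘ χ ∘ element
    cancels : ∀ {χ ω : F → F} → (∀ {x y} → x ≈ y → χ x ≈ χ y) → (∀ x → χ (ω x) ≈ x) →
              ∀ i → conjugate χ (conjugate ω i) ≡ i
    cancels χ-cong χω i = ≡.sym (index-unique (sym (trans (χ-cong (element-index _)) (χω (element i)))))
    π : Permutation q q
    π = permutation (conjugate φ) (conjugate ψ) (cancels φ-cong φψ) (cancels ψ-cong ψφ)

  indicator : ∀ {r} {R : Set r} → Dec R → F → F
  indicator (yes _) x = x
  indicator (no  _) x = 0#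

  -- `R` is an arbitrary predicate that singles out `y`, so that incidence with a line can serve as
  -- well as equality.
  total-indicator : ∀ {r} {R : F → Set r} (R? : ∀ x → Dec (R x)) y {f : F → F} →
    (∀ {x y} → x ≈ y → f x ≈ f y) →
    (∀ {x} → R x → x ≈ y) → (∀ {x} → x ≈ y → R x) → total (λ x → indicator (R? x) (f x)) ≈ f y
  total-indicator {R = R} R? y {f} f-cong R⇒≈ ≈⇒R =
    trans (sum-single _ (index y) λ j j≢ → off (R? (element j)) λ r → j≢ (index-unique (R⇒≈ r)))
          (trans (on (R? (element (index y))) (≈⇒R (element-index y))) (f-cong (element-index y)))
    where
    off : ∀ {x} (d : Dec (R x)) → ¬ R x → indicator d (f x) ≈ 0#
    off (yes r) ¬r = contradiction r ¬r
    off (no  _) ¬r = refl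
    on : ∀ {x} (d : Dec (R x)) → R x → indicator d (f x) ≈ f x
    on (yes _) r = refl
    on (no ¬r) r = contradiction r ¬r

  -- The translation x ↦ x + 1 permutes the field and adds q · 1 to the sum of its elements.
  q·1≈0 : q · 1# ≈ 0#
  q·1≈0 = +-identityʳ-unique (total λ x → x) (q · 1#) (begin
    total (λ x → x) + q · 1#               ≈⟨ +-congˡ (sum-replicate q) ⟨
    total (λ x → x) + total (λ _ → 1#)     ≈⟨ ∑-distrib-+ element (λ _ → 1#) ⟨
    total (λ x → x + 1#)
      ≈⟨ total-reindex (λ x → x) (_+ 1#) (_+ - 1#) (λ e → e) +-congʳ +-congʳ (λ x → cancel x
          (-‿inverseˡ 1#)) (λ x → cancel x (-‿inverseʳ 1#)) ⟨
    total (λ x → x)                        ∎)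
    where
    cancel : ∀ x {y z} → y + z ≈ 0# → x + y + z ≈ x
    cancel x y+z≈0 = trans (+-assoc _ _ _) (trans (+-congˡ y+z≈0) (+-identityʳ x))

  total-1 : total (λ _ → 1#) ≈ 0#
  total-1 = trans (sum-replicate q) q·1≈0

  -- In 𝔽, p^h · 1 is the h-th power of p · 1, so the vanishing of q · 1 descends to p · 1; the
  -- exponent 0 would give 1 = 0.
  characteristic : ∀ p h → q ≡ p ℕ.^ h → p · 1# ≈ 0#
  characteristic p h ≡.refl = root h q·1≈0
    where
    root : ∀ h → (p ℕ.^ h) · 1# ≈ 0# → p · 1# ≈ 0#
    root zero    1≈0 = contradiction (trans (sym (+-identityʳ 1#)) 1≈0) 1≉0
    root (suc h) e with p · 1# ≟ 0#
    ... | yes p≈0 = p≈0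
    ... | no  p≉0 = root h (cancel-nonzero p≉0 (trans (sym (×1-homo-* p (p ℕ.^ h))) e))

  -- The entries of cs are the non-leading coefficients, constant term first.
  monic : ∀ {n} → Vec F n → F → F
  monic []       x = 1#
  monic (c ∷ cs) x = x * monic cs x + c

  -- Synthetic division by X - r: the coefficients of the quotient are the intermediate values of
  -- Horner's scheme at `r`.
  quotient : ∀ {n} → Vec F (suc n) → F → Vec F n
  quotient (c ∷ [])          r = []
  quotient (c ∷ cs@(_ ∷ _)) r = monic cs r ∷ quotient cs r

  monic-division : ∀ {n} (cs : Vec F (suc n)) r x →
    monic cs x ≈ (x - r) * monic (quotient cs r) x + monic cs r
  monic-division (c ∷ []) r x = begin
    x * 1# + c                       ≈⟨ +-congʳ (trans (*-identityʳ x) (sym (+-identityʳ x))) ⟩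
    x + 0# + c                       ≈⟨ +-congʳ (+-congˡ (-‿inverseˡ r)) ⟨
    x + (- r + r) + c
      ≈⟨ S.solve 4 (λ x r y c → x S.:+ (y S.:+ r) S.:+ c
           S.:= (x S.:+ y) S.:* S.con 1 S.:+ (r S.:* S.con 1 S.:+ c))
           refl x r (- r) c ⟩
    (x - r) * 1# + (r * 1# + c)      ∎
  monic-division (c ∷ cs@(_ ∷ _)) r x = begin
    x * monic cs x + c
      ≈⟨ +-congʳ (*-congˡ (monic-division cs r x)) ⟩
    x * ((x - r) * h + g) + c
      ≈⟨ trans (+-congˡ (trans (*-congʳ (-‿inverseʳ r)) (zeroˡ g))) (+-identityʳ _) ⟨
    x * ((x - r) * h + g) + c + (r - r) * g
      ≈⟨ S.solve 6 (λ x r y h g c → x S.:* ((x S.:+ y) S.:* h S.:+ g) S.:+ c S.:+ (r S.:+ y) S.:* g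
           S.:= (x S.:+ y) S.:* (x S.:* h S.:+ g) S.:+ (r S.:* g S.:+ c)) refl x r (- r) h g c ⟩
    (x - r) * (x * h + g) + (r * g + c) ∎
    where
    g = monic cs r
    h = monic (quotient cs r) x

  -- A degree n does not allow n + 1 distinct roots: splitting off one root leaves a monic quotient
  -- that vanishes at the others, and the descent ends at the constant 1.
  monic-roots : ∀ {n} (cs : Vec F n) (r : Fin (suc n) → F) →
    (∀ {i j} → r i ≈ r j → i ≡ j) → ¬ (∀ i → monic cs (r i) ≈ 0#)
  monic-roots []          r inj zeros = 1≉0 (zeros zero)
  monic-roots cs@(_ ∷ _) r inj zeros =
    monic-roots (quotient cs (r zero)) (r ∘ suc) (Fin.suc-injective ∘ inj) λ i →
      cancel-nonzero (λ e → Fin.0≢1+n (inj (sym (x∙y⁻¹≈ε⇒x≈y _ _ e)))) (begin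
        (r (suc i) - r zero) * monic (quotient cs (r zero)) (r (suc i))
          ≈⟨ trans (+-congˡ (zeros zero)) (+-identityʳ _) ⟨
        (r (suc i) - r zero) * monic (quotient cs (r zero)) (r (suc i)) + monic cs (r zero)
          ≈⟨ monic-division cs (r zero) (r (suc i)) ⟨
        monic cs (r (suc i))
          ≈⟨ zeros (suc i) ⟩
        0# ∎)

  monic-zeros : ∀ k x → monic (Vec.replicate k 0#) x ≈ x ^ k
  monic-zeros zero    x = refl
  monic-zeros (suc k) x = trans (+-identityʳ _) (*-congˡ (monic-zeros k x))

  -- If there were no such element, X^(k+2) - X would vanish on the whole field, whose size exceeds
  -- its degree. With this polynomial in place of X^(k+1) - 1, the element found is automatically
  -- nonzero.
  nontrivial-power : ∀ k → 3 ℕ.+ k ≤ q → ∃ λ x → ¬ x ^ suc (suc k) ≈ x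
  nontrivial-power k 3+k≤q with Fin.any? (λ i → ¬? (element i ^ suc (suc k) ≟ element i))
  ... | yes (i , x^k≉x) = element i , x^k≉x
  ... | no  none = contradiction (λ i → vanishes (Fin.inject≤ i 3+k≤q))
    (monic-roots cs (λ i → element (Fin.inject≤ i 3+k≤q)) injective)
    where
    cs : Vec F (suc (suc k))
    -- The coefficients of X^(k+2) - X below the leading one.
    cs = 0# ∷ - 1# ∷ Vec.replicate k 0#
    injective : ∀ {i j} → element (Fin.inject≤ i 3+k≤q) ≈ element (Fin.inject≤ j 3+k≤q) → i ≡ j
    injective e = Fin.inject≤-injective 3+k≤q 3+k≤q _ _
      (≡.trans (index-unique e) (≡.sym (index-unique refl)))
    vanishes : ∀ i → monic cs (element i) ≈ 0#
    vanishes i = begin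
      x * (x * monic (Vec.replicate k 0#) x + - 1#) + 0#
        ≈⟨ trans (+-identityʳ _) (*-congˡ (+-congʳ (*-congˡ (monic-zeros k x)))) ⟩
      x * (x ^ suc k + - 1#)
        ≈⟨ trans (distribˡ _ _ _) (+-congˡ (trans (sym (-‿distribʳ-* x 1#)) (-‿cong (*-identityʳ x)))) ⟩
      x ^ suc (suc k) - x
        ≈⟨ x≈y⇒x∙y⁻¹≈ε (decidable-stable (x ^ suc (suc k) ≟ x) (λ x^k≉x → none (i , x^k≉x))) ⟩
      0# ∎
      where x = element i

  power-cong : ∀ k {x y} → x ≈ y → power k x ≈ power k y
  power-cong k x≈y = *-cong x≈y (^-congˡ k (-‿cong x≈y))

  power-* : ∀ k b x → power k (b * x) ≈ b ^ suc k * power k x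
  power-* k b x = begin
    b * x * (- (b * x)) ^ k        ≈⟨ *-congˡ (trans (^-congˡ k (-‿distribʳ-* b x)) (^-distrib-* b (- x) k)) ⟩
    b * x * (b ^ k * (- x) ^ k)    ≈⟨ S.solve 4 (λ b x c d → b S.:* x S.:* (c S.:* d)
         S.:= b S.:* c S.:* (x S.:* d))
         refl b x (b ^ k) ((- x) ^ k) ⟩
    b * b ^ k * (x * (- x) ^ k)    ∎

  -- The substitution x ↦ b x permutes the field and multiplies the sum by b^(k+1), which differs
  -- from 1. The exponent in `power k` is k + 1, so the bound says that it is at most q - 2.
  total-power : ∀ k → 3 ℕ.+ k ≤ q → total (power k) ≈ 0#
  total-power k 3+k≤q with nontrivial-power k 3+k≤q
  ... | b , b^k≉b = cancel-nonzero b^[k+1]-1≉0 (begin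
    (b ^ suc k - 1#) * total (power k)
      ≈⟨ [y-z]x≈yx-zx _ _ _ ⟩
    b ^ suc k * total (power k) - 1# * total (power k)
      ≈⟨ +-cong (sym scaled) (-‿cong (*-identityˡ _)) ⟩
    total (power k) - total (power k)
      ≈⟨ -‿inverseʳ _ ⟩
    0# ∎)
    where
    b≉0 : ¬ b ≈ 0#
    b≉0 b≈0 = b^k≉b (trans (*-congʳ b≈0) (trans (zeroˡ _) (sym b≈0)))
    b^[k+1]-1≉0 : ¬ b ^ suc k - 1# ≈ 0#
    b^[k+1]-1≉0 e = b^k≉b (trans (*-congˡ (x∙y⁻¹≈ε⇒x≈y _ _ e)) (*-identityʳ b))
    b⁻¹ : F
    b⁻¹ = proj₁ (invertible b b≉0)
    scaled : total (power k) ≈ b ^ suc k * total (power k)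
    scaled = begin
      total (power k)
        ≈⟨ total-reindex (power k) (b *_) (b⁻¹ *_) (power-cong k) *-congˡ *-congˡ
             (λ x → trans (sym (*-assoc _ _ _)) (trans (*-congʳ (proj₂ (proj₂ (invertible b b≉0)))) (*-identityˡ x)))
             (λ x → trans (sym (*-assoc _ _ _)) (trans (*-congʳ (proj₁ (proj₂ (invertible b b≉0)))) (*-identityˡ x))) ⟩
      total (λ x → power k (b * x))       ≈⟨ total-cong (power-* k b) ⟩
      total (λ x → b ^ suc k * power k x) ≈⟨ *-distribˡ-sum (b ^ suc k) (power k ∘ element) ⟨
      b ^ suc k * total (power k)         ∎

-- Sums over points grouped by level, and lists with multiplicities.

module WeightedSums {a ℓ : Level} {q : ℕ} (𝔽 : FiniteField a ℓ q) where
  open FiniteField 𝔽 hiding (zero) renaming (Carrier to F)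
  open FiniteFieldSums 𝔽
  open SemiringSum semiring
  open Mult semiring renaming (_×_ to _·_)
  open Newton commutativeRing
  open SumOverSupport +-commutativeMonoid
  open SetoidReasoning setoid
  private module S = SemiringSolver commutativeSemiring

  sum-over-++ : ∀ L M f → sum-over (L ++ M) f ≈ sum-over L f + sum-over M f
  sum-over-++ []      M f = sym (+-identityˡ _)
  sum-over-++ (x ∷ L) M f = trans (+-congˡ (sum-over-++ L M f)) (sym (+-assoc _ _ _))

  sum-over-replicate : ∀ n x f → sum-over (replicate n x) f ≈ n · 1# * f x
  sum-over-replicate zero    x f = sym (zeroˡ _)
  sum-over-replicate (suc n) x f = begin
    f x + sum-over (replicate n x) f ≈⟨ +-cong (*-identityˡ _) (sym (sum-over-replicate n x f)) ⟨
    1# * f x + n · 1# * f x          ≈⟨ distribʳ _ _ _ ⟨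
    (1# + n · 1#) * f x              ∎

  sum-over-1 : ∀ L → sum-over L (λ _ → 1#) ≈ length L · 1#
  sum-over-1 []      = refl
  sum-over-1 (x ∷ L) = +-congˡ (sum-over-1 L)

  repeat : ∀ {b} {B : Set b} → ℕ → List B → List B
  repeat n = concatMap (replicate n)

  sum-over-repeat : ∀ {b} {B : Set b} (val : B → F) n T f →
    sum-over (map val (repeat n T)) f ≈ n · 1# * sum-over (map val T) f
  sum-over-repeat val n []      f = sym (zeroʳ _)
  sum-over-repeat val n (P ∷ T) f = begin
    sum-over (map val (replicate n P ++ repeat n T)) f
      ≡⟨ ≡.cong (λ L → sum-over L f) (≡.trans (map-++ val (replicate n P) (repeat n T))
          (≡.cong (_++ map val (repeat n T)) (map-replicate val n P))) ⟩
    sum-over (replicate n (val P) ++ map val (repeat n T)) f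
      ≈⟨ sum-over-++ (replicate n (val P)) (map val (repeat n T)) f ⟩
    sum-over (replicate n (val P)) f + sum-over (map val (repeat n T)) f
      ≈⟨ +-cong (sum-over-replicate n (val P) f) (sum-over-repeat val n T f) ⟩
    n · 1# * f (val P) + n · 1# * sum-over (map val T) f
      ≈⟨ distribˡ _ _ _ ⟨
    n · 1# * (f (val P) + sum-over (map val T) f) ∎

  -- `R x P` stands for incidence of the point `P` with the line at level `x`; the weights are then
  -- literally intersection sizes of lines with the multiset.
  sum-over-by-value : ∀ {b r} {B : Set b} (val : B → F) {R : F → B → Set r} (R? : ∀ x P → Dec (R x P)) →
    (∀ {x P} → R x P → x ≈ val P) → (∀ {x P} → x ≈ val P → R x P) →
    ∀ (f : F → F) → (∀ {x y} → x ≈ y → f x ≈ f y) → ∀ T →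
    sum-over (map val T) f ≈ total (λ x → length (filter (R? x) T) · 1# * f x)
  sum-over-by-value val R? R⇒≈ ≈⇒R f f-cong [] =
      sym (sum-zero ((λ x → length (filter (R? x) []) · 1# * f x) ∘ element) λ i → zeroˡ (f (element i)))
  sum-over-by-value val {R} R? R⇒≈ ≈⇒R f f-cong (P ∷ T) = begin
    f (val P) + sum-over (map val T) f
      ≈⟨ +-cong (sym (total-indicator (λ x → R? x P) (val P) f-cong R⇒≈ ≈⇒R))
          (sum-over-by-value val R? R⇒≈ ≈⇒R f f-cong T) ⟩
    total (λ x → indicator (R? x P) (f x)) + total (λ x → count T x · 1# * f x)
      ≈⟨ ∑-distrib-+ ((λ x → indicator (R? x P) (f x)) ∘ element) ((λ x → count T x · 1# * f x) ∘ element) ⟨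
    total (λ x → indicator (R? x P) (f x) + count T x · 1# * f x)
      ≈⟨ total-cong {λ x → indicator (R? x P) (f x) + count T x · 1# * f x}
          {λ x → count (P ∷ T) x · 1# * f x} (λ x → step x (R? x P)) ⟩
    total (λ x → count (P ∷ T) x · 1# * f x) ∎
    where
    count : List _ → F → ℕ
    count T x = length (filter (R? x) T)
    step : ∀ x (d : Dec (R x P)) → indicator d (f x) + count T x · 1# * f x ≈ count (P ∷ T) x · 1# * f x
    step x (yes r) = begin
      f x + count T x · 1# * f x      ≈⟨ S.solve 2 (λ y n → y S.:+ n S.:* y S.:= (S.con 1 S.:+ n) S.:* y)
           refl (f x) (count T x · 1#) ⟩
      (1# + count T x · 1#) * f x     ≡⟨ ≡.cong (λ L → length L · 1# * f x) (filter-accept (R? x) r) ⟨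
      count (P ∷ T) x · 1# * f x      ∎
    step x (no ¬r) = begin
      0# + count T x · 1# * f x       ≈⟨ +-identityˡ _ ⟩
      count T x · 1# * f x            ≡⟨ ≡.cong (λ L → length L · 1# * f x) (filter-reject (R? x) ¬r) ⟨
      count (P ∷ T) x · 1# * f x      ∎

  with-multiplicities : ∀ {n} → (Fin n → F) → (Fin n → ℕ) → List F
  with-multiplicities {zero}  α μ = []
  with-multiplicities {suc n} α μ = replicate (μ zero) (α zero) ++ with-multiplicities (α ∘ suc) (μ ∘ suc)

  length-with-multiplicities : ∀ {n} (α : Fin n → F) μ → length (with-multiplicities α μ) ≡ sumℕ μ
  length-with-multiplicities {zero}  α μ = ≡.refl
  length-with-multiplicities {suc n} α μ = ≡.trans (length-++ (replicate (μ zero) (α zero)))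
    (≡.cong₂ ℕ._+_ (length-replicate (μ zero)) (length-with-multiplicities (α ∘ suc) (μ ∘ suc)))

  sum-over-with-multiplicities : ∀ {n} (α : Fin n → F) μ f →
    sum-over (with-multiplicities α μ) f ≈ sum (λ i → μ i · 1# * f (α i))
  sum-over-with-multiplicities {zero}  α μ f = refl
  sum-over-with-multiplicities {suc n} α μ f = trans
    (sum-over-++ (replicate (μ zero) (α zero)) (with-multiplicities (α ∘ suc) (μ ∘ suc)) f)
    (+-cong (sum-over-replicate (μ zero) (α zero) f) (sum-over-with-multiplicities (α ∘ suc) (μ ∘ suc) f))

  absent : ∀ {n} (α : Fin n → F) μ {γ} → (∀ i → ¬ α i ≈ γ) → All (λ x → ¬ x ≈ γ) (with-multiplicities α μ)
  absent {zero}  α μ α≉γ = []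
  absent {suc n} α μ α≉γ = ++⁺ (replicate⁺ (μ zero) (α≉γ zero)) (absent (α ∘ suc) (μ ∘ suc) (α≉γ ∘ suc))

  -- Distinct `α` keep the blocks of equal entries apart. This count becomes the intersection
  -- multiplicity with the pencil.
  multiplicity : ∀ {n} (α : Fin n → F) μ → (∀ {i j} → α i ≈ α j → i ≡ j) → ∀ i →
    length (filter (_≟ α i) (with-multiplicities α μ)) ≡ μ i
  multiplicity {suc n} α μ inj i = ≡.trans
    (≡.cong length (filter-++ (_≟ α i) (replicate (μ zero) (α zero)) (with-multiplicities (α ∘ suc) (μ ∘ suc))))
    (≡.trans (length-++ (filter (_≟ α i) (replicate (μ zero) (α zero)))) (split i))
    where
    tail : Fin (suc n) → ℕ
    tail i = length (filter (_≟ α i) (with-multiplicities (α ∘ suc) (μ ∘ suc)))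
    split : ∀ i → length (filter (_≟ α i) (replicate (μ zero) (α zero))) ℕ.+ tail i ≡ μ i
    split zero = ≡.trans
      (≡.cong₂ ℕ._+_
        (≡.trans (≡.cong length (filter-all (_≟ α zero) (replicate⁺ (μ zero) refl))) (length-replicate (μ zero)))
        (≡.cong length (filter-none (_≟ α zero) (absent (α ∘ suc) (μ ∘ suc) λ j e → Fin.0≢1+n (≡.sym (inj e))))))
      (ℕ.+-identityʳ (μ zero))
    split (suc i) = ≡.cong₂ ℕ._+_
      (≡.cong length (filter-none (_≟ α (suc i)) (replicate⁺ (μ zero) λ e → Fin.0≢1+n (inj e))))
      (multiplicity (α ∘ suc) (μ ∘ suc) (Fin.suc-injective ∘ inj) i)

  -- The typical value `m` is multiplied by the total of `f`, which is zero; only the excess over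
  -- `m` at the exceptional levels survives.
  total-of-exceptions : ∀ {n} (t : F → F) (α : Fin n → F) (μ : Fin n → ℕ) m c →
    (∀ {i j} → α i ≈ α j → i ≡ j) →
    (∀ {i x} → α i ≈ x → t x ≈ m + c * μ i · 1#) → (∀ {x} → (∀ i → ¬ α i ≈ x) → t x ≈ m) →
    ∀ (f : F → F) → (∀ {x y} → x ≈ y → f x ≈ f y) → total f ≈ 0# →
    total (λ x → t x * f x) ≈ c * sum-over (with-multiplicities α μ) f
  total-of-exceptions {n} t α μ m c inj at-α elsewhere f f-cong f≈0 = begin
    total (λ x → t x * f x)
      ≈⟨ total-cong {λ x → t x * f x} {λ x → m * f x + c * sum (λ i → bump i x)} pointwise ⟩
    total (λ x → m * f x + c * sum (λ i → bump i x))
      ≈⟨ ∑-distrib-+ ((λ x → m * f x) ∘ element) ((λ x → c * sum (λ i → bump i x)) ∘ element) ⟩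
    total (λ x → m * f x) + total (λ x → c * sum (λ i → bump i x))
      ≈⟨ +-cong (*-distribˡ-sum m (f ∘ element)) (*-distribˡ-sum c ((λ x → sum (λ i → bump i x)) ∘ element)) ⟨
    m * total f + c * total (λ x → sum (λ i → bump i x))
      ≈⟨ +-cong (trans (*-congˡ f≈0) (zeroʳ m)) (*-congˡ (begin
           total (λ x → sum (λ i → bump i x)) ≈⟨ ∑-comm (λ j i → bump i (element j)) ⟩
           sum (λ i → total (bump i))         ≈⟨ sum-cong-≋ (λ i → total-indicator (α i ≟_) (α i)
               {λ x → μ i · 1# * f x} (*-congˡ ∘ f-cong) sym sym) ⟩
           sum (λ i → μ i · 1# * f (α i))     ≈⟨ sum-over-with-multiplicities α μ f ⟨
           sum-over (with-multiplicities α μ) f ∎)) ⟩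
    0# + c * sum-over (with-multiplicities α μ) f
      ≈⟨ +-identityˡ _ ⟩
    c * sum-over (with-multiplicities α μ) f ∎
    where
    bump : Fin n → F → F
    bump i x = indicator (α i ≟ x) (μ i · 1# * f x)
    on : ∀ {i x} (d : Dec (α i ≈ x)) → α i ≈ x → indicator d (μ i · 1# * f x) ≈ μ i · 1# * f x
    on (yes _) e = refl
    on (no ≉)  e = contradiction e ≉
    off : ∀ {i x} (d : Dec (α i ≈ x)) → ¬ α i ≈ x → indicator d (μ i · 1# * f x) ≈ 0#
    off (yes e) ≉ = contradiction e ≉
    off (no _)  ≉ = refl
    pointwise : ∀ x → t x * f x ≈ m * f x + c * sum (λ i → bump i x)
    -- As `α` is injective, at most one exception sits at `x`, so the sum of bumps has at most one
    -- nonzero term.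
    pointwise x with Fin.any? (λ i → α i ≟ x)
    ... | yes (i , αᵢ≈x) = begin
      t x * f x
        ≈⟨ *-congʳ (at-α αᵢ≈x) ⟩
      (m + c * μ i · 1#) * f x
        ≈⟨ S.solve 4 (λ m c μ f → (m S.:+ c S.:* μ) S.:* f S.:= m S.:* f S.:+ c S.:* (μ S.:* f))
             refl m c (μ i · 1#) (f x) ⟩
      m * f x + c * (μ i · 1# * f x)
        ≈⟨ +-congˡ (*-congˡ (trans (sum-single (λ i → bump i x) i λ j j≢i → off (α j ≟ x) λ αⱼ≈x → j≢i (inj (trans αⱼ≈x (sym αᵢ≈x)))) (on (α i ≟ x) αᵢ≈x))) ⟨
      m * f x + c * sum (λ i → bump i x) ∎
    ... | no none = begin
      t x * f x                          ≈⟨ *-congʳ (elsewhere λ i e → none (i , e)) ⟩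
      m * f x                            ≈⟨ trans (+-congˡ (zeroʳ c)) (+-identityʳ _) ⟨
      m * f x + c * 0#                   ≈⟨ +-congˡ (*-congˡ (sum-zero (λ i → bump i x) λ i → off (α i ≟ x) λ e → none (i , e))) ⟨
      m * f x + c * sum (λ i → bump i x) ∎

-- Integers modulo p inside the field.

module PrimeCharacteristic {a ℓ : Level} {q : ℕ} (𝔽 : FiniteField a ℓ q) (p : ℕ) (p-prime : Prime p)
  (p≈0 : CommutativeRing._≈_ (FiniteField.commutativeRing 𝔽)
    (Mult._×_ (CommutativeRing.semiring (FiniteField.commutativeRing 𝔽)) p (FiniteField.1# 𝔽)) (FiniteField.0# 𝔽))
  where
  open FiniteField 𝔽 hiding (zero) renaming (Carrier to F)
  open FieldProperties 𝔽
  open Mult semiring renaming (_×_ to _·_)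
  open SetoidReasoning setoid
  open RingProperties ring using (+-identityʳ-unique)
  private module S = SemiringSolver commutativeSemiring

  multiple≈0 : ∀ k → (k ℕ.* p) · 1# ≈ 0#
  multiple≈0 k = trans (×1-homo-* k p) (trans (*-congˡ p≈0) (zeroʳ _))

  ·-mod : ∀ r k → (r ℕ.+ k ℕ.* p) · 1# ≈ r · 1#
  ·-mod r k = trans (×-homo-+ 1# r (k ℕ.* p)) (trans (+-congˡ (multiple≈0 k)) (+-identityʳ _))

  ·-congruent-≤ : ∀ {m n} → m ≤ n → p ℕ.∣ n ∸ m → m · 1# ≈ n · 1#
  ·-congruent-≤ {m} {n} m≤n (ℕ.divides k n∸m≡kp) = begin
    m · 1#                ≈⟨ ·-mod m k ⟨
    (m ℕ.+ k ℕ.* p) · 1#  ≡⟨ ≡.cong (λ d → (m ℕ.+ d) · 1#) n∸m≡kp ⟨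
    (m ℕ.+ (n ∸ m)) · 1#  ≡⟨ ≡.cong (_· 1#) (ℕ.m+[n∸m]≡n m≤n) ⟩
    n · 1#                ∎

  ·-congruent : ∀ m n → + m ≡ + n [mod p ] → m · 1# ≈ n · 1#
  ·-congruent m n p∣m-n with ℕ.≤-total m n
  ... | inj₁ m≤n = ·-congruent-≤ m≤n (≡.subst (p ℕ.∣_)
          (≡.trans (≡.cong ℤ.∣_∣ (ℤ.m-n≡m⊖n m n)) (ℤ.∣⊖∣-≤ m≤n)) p∣m-n)
  ... | inj₂ n≤m = sym (·-congruent-≤ n≤m (≡.subst (p ℕ.∣_)
          (≡.cong ℤ.∣_∣ (≡.trans (ℤ.m-n≡m⊖n m n) (ℤ.⊖-≥ n≤m))) p∣m-n))

  -- The inverse has to be a natural number, as it will be a number of copies of each point.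
  -- Bézout's identity over ℕ gives xk congruent to 1 or to -1 modulo p.
  ·-invertible : ∀ {k} → ¬ p ℕ.∣ k → ∃ λ k⁻¹ → k⁻¹ · 1# * k · 1# ≈ 1#
  ·-invertible {k} p∤k with coprime-Bézout coprime
    where
    coprime : Coprime k p
    coprime (d∣k , d∣p) with prime⇒irreducible p-prime d∣p
    ... | inj₁ d≡1    = d≡1
    ... | inj₂ ≡.refl = contradiction d∣k p∤k
  ... | Bézout.+- x y 1+yp≡xk = x , (begin
    x · 1# * k · 1#      ≈⟨ ×1-homo-* x k ⟨
    (x ℕ.* k) · 1#       ≡⟨ ≡.cong (_· 1#) 1+yp≡xk ⟨
    (1 ℕ.+ y ℕ.* p) · 1# ≈⟨ ·-mod 1 y ⟩
    1 · 1#               ≈⟨ +-identityʳ 1# ⟩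
    1#                   ∎)
  -- Here xk = -1 in 𝔽, so x²k is the inverse.
  ... | Bézout.-+ x y 1+xk≡yp = x ℕ.* x ℕ.* k , (begin
    (x ℕ.* x ℕ.* k) · 1# * k · 1#
      ≈⟨ *-congʳ (trans (×1-homo-* (x ℕ.* x) k) (*-congʳ (×1-homo-* x x))) ⟩
    x · 1# * x · 1# * k · 1# * k · 1#
      ≈⟨ S.solve 2 (λ x k → x S.:* x S.:* k S.:* k S.:= (x S.:* k) S.:* (x S.:* k)) refl (x · 1#) (k · 1#) ⟩
    z * z
      ≈⟨ trans (+-congˡ 1+z≈0) (+-identityʳ _) ⟨
    z * z + (1# + z)
      ≈⟨ S.solve 1 (λ z → z S.:* z S.:+ (S.con 1 S.:+ z) S.:= z S.:* (S.con 1 S.:+ z) S.:+ S.con 1) refl z ⟩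
    z * (1# + z) + 1#
      ≈⟨ trans (+-congʳ (trans (*-congˡ 1+z≈0) (zeroʳ z))) (+-identityˡ 1#) ⟩
    1# ∎)
    where
    z : F
    z = x · 1# * k · 1#
    1+z≈0 : 1# + z ≈ 0#
    1+z≈0 = begin
      1# + z                 ≈⟨ +-congˡ (×1-homo-* x k) ⟨
      (1 ℕ.+ x ℕ.* k) · 1#   ≡⟨ ≡.cong (_· 1#) 1+xk≡yp ⟩
      (y ℕ.* p) · 1#         ≈⟨ multiple≈0 y ⟩
      0#                     ∎

  suc-·≉0 : ∀ {k} → suc k < p → ¬ suc k · 1# ≈ 0#
  suc-·≉0 {k} 1+k<p k≈0 with ·-invertible (λ p∣k → ℕ.<⇒≱ 1+k<p (ℕ.∣⇒≤ p∣k))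
  ... | _ , inverse = 1≉0 (trans (sym inverse) (trans (*-congˡ k≈0) (zeroʳ _)))

  suc-·-cancel : ∀ {k} → suc k < p → ∀ {x y} → suc k · x ≈ suc k · y → x ≈ y
  suc-·-cancel {k} 1+k<p {x} {y} e = *-cancelˡ-nonzero (suc-·≉0 1+k<p) (trans (as-product x)
      (trans e (sym (as-product y))))
    where
    as-product : ∀ x → suc k · 1# * x ≈ suc k · x
    as-product x = trans (×-assoc-* (suc k) 1# x) (×-congʳ (suc k) (*-identityˡ x))

  -- Otherwise n - m, a positive integer below p, would vanish in 𝔽.
  ·-injective-≤ : ∀ {m n} → m ≤ n → n < p → m · 1# ≈ n · 1# → m ≡ n
  ·-injective-≤ {m} {n} m≤n n<p e with n ∸ m in n∸m≡d
  ... | zero  = ℕ.≤-antisym m≤n (ℕ.m∸n≡0⇒m≤n n∸m≡d)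
  ... | suc d = contradiction (+-identityʳ-unique (m · 1#) (suc d · 1#) (begin
    m · 1# + suc d · 1#  ≈⟨ ×-homo-+ 1# m (suc d) ⟨
    (m ℕ.+ suc d) · 1#   ≡⟨ ≡.cong (λ d → (m ℕ.+ d) · 1#) n∸m≡d ⟨
    (m ℕ.+ (n ∸ m)) · 1# ≡⟨ ≡.cong (_· 1#) (ℕ.m+[n∸m]≡n m≤n) ⟩
    n · 1#               ≈⟨ e ⟨
    m · 1#               ∎))
    (suc-·≉0 (ℕ.≤-<-trans (≡.subst (_≤ n) n∸m≡d (ℕ.m∸n≤m n m)) n<p))

  ·-injective : ∀ {m n} → m < p → n < p → m · 1# ≈ n · 1# → m ≡ n
  ·-injective {m} {n} m<p n<p e with ℕ.≤-total m n
  ... | inj₁ m≤n = ·-injective-≤ m≤n n<p e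
  ... | inj₂ n≤m = ≡.sym (·-injective-≤ n≤m m<p (sym e))

-- Lines through a point at infinity.

module Pencils {a ℓ : Level} {q : ℕ} (𝔽 : FiniteField a ℓ q) where
  open FiniteField 𝔽 hiding (zero) renaming (Carrier to F)
  open Plane 𝔽
  open Homogeneous
  open FieldProperties 𝔽
  open ElementarySymmetric commutativeSemiring using (linear)
  open RingProperties ring
  open SetoidReasoning setoid
  private module S = SemiringSolver commutativeSemiring

  ∼-sym : ∀ {l l′} → l ∼ l′ → l′ ∼ l
  ∼-sym {l} {l′} (k , k≉0 , e₁ , e₂ , e₃) =
    k⁻¹ , (λ k⁻¹≈0 → 1≉0 (trans (sym k⁻¹k≈1) (trans (*-congʳ k⁻¹≈0) (zeroˡ k)))) , undo e₁ , undo e₂ , undo e₃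
    where
    k⁻¹ : F
    k⁻¹ = proj₁ (invertible k k≉0)
    k⁻¹k≈1 : k⁻¹ * k ≈ 1#
    k⁻¹k≈1 = proj₁ (proj₂ (invertible k k≉0))
    undo : ∀ {x y} → y ≈ k * x → x ≈ k⁻¹ * y
    undo {x} {y} y≈kx = begin
      x             ≈⟨ *-identityˡ x ⟨
      1# * x        ≈⟨ *-congʳ k⁻¹k≈1 ⟨
      k⁻¹ * k * x   ≈⟨ *-assoc k⁻¹ k x ⟩
      k⁻¹ * (k * x) ≈⟨ *-congˡ y≈kx ⟨
      k⁻¹ * y       ∎

  ∼-trans : ∀ {l l′ l″} → l ∼ l′ → l′ ∼ l″ → l ∼ l″
  ∼-trans (k , k≉0 , e₁ , e₂ , e₃) (k′ , k′≉0 , e₁′ , e₂′ , e₃′) =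
    k′ * k , (λ e → k≉0 (cancel-nonzero k′≉0 e)) , chain e₁ e₁′ , chain e₂ e₂′ , chain e₃ e₃′
    where
    chain : ∀ {x y z} → y ≈ k * x → z ≈ k′ * y → z ≈ k′ * k * x
    chain y≈kx z≈k′y = trans z≈k′y (trans (*-congˡ y≈kx) (sym (*-assoc k′ k _)))

  ∈ₗ-resp-∼ : ∀ {P l l′} → l ∼ l′ → P ∈ₗ l → P ∈ₗ l′
  ∈ₗ-resp-∼ {P} {l} {l′} (k , _ , e₁ , e₂ , e₃) P∈l = begin
    c₁ l′ * c₁ P + c₂ l′ * c₂ P + c₃ l′ * c₃ P
      ≈⟨ +-cong (+-cong (*-congʳ e₁) (*-congʳ e₂)) (*-congʳ e₃) ⟩
    k * c₁ l * c₁ P + k * c₂ l * c₂ P + k * c₃ l * c₃ P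
      ≈⟨ S.solve 7 (λ k a b c x y z → k S.:* a S.:* x S.:+ k S.:* b S.:* y S.:+ k S.:* c S.:* z
           S.:= k S.:* (a S.:* x S.:+ b S.:* y S.:+ c S.:* z)) refl k (c₁ l) (c₂ l) (c₃ l) (c₁ P) (c₂ P) (c₃ P) ⟩
    k * (c₁ l * c₁ P + c₂ l * c₂ P + c₃ l * c₃ P)
      ≈⟨ trans (*-congˡ P∈l) (zeroʳ k) ⟩
    0# ∎

  #-resp-∼ : ∀ {l l′} → l ∼ l′ → ∀ T → # l ∩ T ≡ # l′ ∩ T
  #-resp-∼ {l} {l′} l∼l′ T = ≡.cong length (filter-≐ (λ P → embed P ∈ₗ? l) (λ P → embed P ∈ₗ? l′)
    ((λ {P} → ∈ₗ-resp-∼ {embed P} {l} {l′} l∼l′) , (λ {P} → ∈ₗ-resp-∼ {embed P} {l′} {l} (∼-sym {l} {l′} l∼l′))) T)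

  -- The lines through ⟨ d ⟩ are those of the form [ρ d s : τ d s : w].
  ρ τ : Direction → F
  ρ (slope d) = - d
  ρ ∞         = 1#
  τ (slope d) = 1#
  τ ∞         = 0#

  ρ,τ-nonzero : ∀ d → ¬ (ρ d ≈ 0# × τ d ≈ 0#)
  ρ,τ-nonzero (slope d) (_ , e) = 1≉0 e
  ρ,τ-nonzero ∞         (e , _) = 1≉0 e

  ∈-pencil : ∀ d l {s} → c₁ l ≈ ρ d * s → c₂ l ≈ τ d * s → ⟨ d ⟩ ∈ₗ l
  ∈-pencil (slope d) l {s} e₁ e₂ = begin
    c₁ l * 1# + c₂ l * d + c₃ l * 0#      ≈⟨ +-congʳ (+-cong (*-congʳ e₁) (*-congʳ e₂)) ⟩
    - d * s * 1# + 1# * s * d + c₃ l * 0#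
      ≈⟨ S.solve 4 (λ y s d w → y S.:* s S.:* S.con 1 S.:+ S.con 1 S.:* s S.:* d S.:+ w S.:* S.con 0 S.:= (y S.:+ d) S.:* s)
           refl (- d) s d (c₃ l) ⟩
    (- d + d) * s                         ≈⟨ trans (*-congʳ (-‿inverseˡ d)) (zeroˡ s) ⟩
    0#                                    ∎
  ∈-pencil ∞ l {s} e₁ e₂ = begin
    c₁ l * 0# + c₂ l * 1# + c₃ l * 0#     ≈⟨ S.solve 3 (λ x y z → x S.:* S.con 0 S.:+ y S.:* S.con 1 S.:+ z S.:* S.con 0
         S.:= y)
         refl _ _ _ ⟩
    c₂ l                                  ≈⟨ trans e₂ (zeroˡ s) ⟩
    0#                                    ∎

  pencil-parameter : ∀ d l → ⟨ d ⟩ ∈ₗ l → ∃ λ s → c₁ l ≈ ρ d * s × c₂ l ≈ τ d * s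
  pencil-parameter (slope d) l ∈l = c₂ l , x∙y⁻¹≈ε⇒x≈y _ _ (begin
    c₁ l - - d * c₂ l                     ≈⟨ +-congˡ (trans
        (-‿distribˡ-* (- d) (c₂ l)) (*-congʳ (-‿involutive d))) ⟩
    c₁ l + d * c₂ l                       ≈⟨ S.solve 4 (λ x y z d → x S.:+ d S.:* y
         S.:= x S.:* S.con 1 S.:+ y S.:* d S.:+ z S.:* S.con 0)
         refl _ _ (c₃ l) d ⟩
    c₁ l * 1# + c₂ l * d + c₃ l * 0#      ≈⟨ ∈l ⟩
    0#                                    ∎) , sym (*-identityˡ _)
  pencil-parameter ∞ l ∈l = c₁ l , sym (*-identityˡ _) , (begin
    c₂ l                                  ≈⟨ S.solve 3 (λ x y z → y
         S.:= x S.:* S.con 0 S.:+ y S.:* S.con 1 S.:+ z S.:* S.con 0)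
         refl (c₁ l) _ (c₃ l) ⟩
    c₁ l * 0# + c₂ l * 1# + c₃ l * 0#     ≈⟨ ∈l ⟩
    0#                                    ≈⟨ zeroˡ _ ⟨
    0# * c₁ l                             ∎)

  -- The affine line on which the linear form ρ d X + τ d Y takes the value x.
  level : Direction → F → Line
  level d x = mk (ρ d) (τ d) (- x) λ (e₁ , e₂ , _) → ρ,τ-nonzero d (e₁ , e₂)

  level-cong : ∀ d {x y} → x ≈ y → level d x ∼ level d y
  level-cong d x≈y = 1# , 1≉0 , sym (*-identityˡ _) , sym (*-identityˡ _) , trans
      (-‿cong (sym x≈y)) (sym (*-identityˡ _))

  -- One of `ρ d` and `τ d` is 1, so the factor of proportionality is 1 and the third coordinates
  -- agree.
  level-injective : ∀ d {x y} → level d x ∼ level d y → x ≈ y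
  level-injective d {x} {y} (k , _ , e₁ , e₂ , e₃) =
    sym (-‿injective (trans e₃ (trans (*-congʳ (k≈1 d e₁ e₂)) (*-identityˡ _))))
    where
    k≈1 : ∀ d → ρ d ≈ k * ρ d → τ d ≈ k * τ d → k ≈ 1#
    k≈1 (slope d) _ e = trans (sym (*-identityʳ k)) (sym e)
    k≈1 ∞         e _ = trans (sym (*-identityʳ k)) (sym e)

  level-hasSlope : ∀ d x → HasSlope d (level d x)
  level-hasSlope d x =
    ∈-pencil d (level d x) {1#} (sym (*-identityʳ _)) (sym (*-identityʳ _)) ,
    λ (k , k≉0 , e₁ , e₂ , _) → ρ,τ-nonzero d (cancel-nonzero k≉0 (sym e₁) , cancel-nonzero k≉0 (sym e₂))

  ∈-level⇒ : ∀ d {x} P → embed P ∈ₗ level d x → x ≈ linear (ρ d) (τ d) P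
  ∈-level⇒ d {x} (X , Y) ∈l = sym (x∙y⁻¹≈ε⇒x≈y _ _ (begin
    X * ρ d + Y * τ d - x
      ≈⟨ S.solve 5 (λ X Y r t x → X S.:* r S.:+ Y S.:* t S.:+ x S.:= r S.:* X S.:+ t S.:* Y S.:+ x S.:* S.con 1)
           refl X Y (ρ d) (τ d) (- x) ⟩
    ρ d * X + τ d * Y + - x * 1#
      ≈⟨ ∈l ⟩
    0# ∎))

  ⇒∈-level : ∀ d {x} P → x ≈ linear (ρ d) (τ d) P → embed P ∈ₗ level d x
  ⇒∈-level d {x} (X , Y) x≈ = begin
    ρ d * X + τ d * Y + - x * 1#
      ≈⟨ S.solve 5 (λ X Y r t x → r S.:* X S.:+ t S.:* Y S.:+ x S.:* S.con 1 S.:= X S.:* r S.:+ Y S.:* t S.:+ x)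
           refl X Y (ρ d) (τ d) (- x) ⟩
    X * ρ d + Y * τ d - x
      ≈⟨ x≈y⇒x∙y⁻¹≈ε (sym x≈) ⟩
    0# ∎

  -- A line [ρ s : τ s : w] of the pencil with s = 0 is the line at infinity. For an affine line,
  -- division by s gives the level -w/s.
  hasSlope-level : ∀ d l → HasSlope d l → ∃ λ x → level d x ∼ l
  hasSlope-level d l (∈l , l≁ℓ∞) with pencil-parameter d l ∈l
  ... | s , e₁ , e₂ = - (s⁻¹ * c₃ l) , s , s≉0 , trans e₁ (*-comm _ _) , trans e₂ (*-comm _ _) , (begin
    c₃ l                  ≈⟨ *-identityˡ _ ⟨
    1# * c₃ l             ≈⟨ *-congʳ (proj₂ (proj₂ (invertible s s≉0))) ⟨
    s * s⁻¹ * c₃ l        ≈⟨ *-assoc _ _ _ ⟩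
    s * (s⁻¹ * c₃ l)      ≈⟨ *-congˡ (-‿involutive _) ⟨
    s * - - (s⁻¹ * c₃ l)  ∎)
    where
    s≉0 : ¬ s ≈ 0#
    s≉0 s≈0 = l≁ℓ∞ (k , k≉0 , null c₁l≈0 , null c₂l≈0 , sym (proj₁ (proj₂ (invertible (c₃ l) c₃≉0))))
      where
      c₁l≈0 : c₁ l ≈ 0#
      c₁l≈0 = trans e₁ (trans (*-congˡ s≈0) (zeroʳ _))
      c₂l≈0 : c₂ l ≈ 0#
      c₂l≈0 = trans e₂ (trans (*-congˡ s≈0) (zeroʳ _))
      c₃≉0 : ¬ c₃ l ≈ 0#
      c₃≉0 e = nonzero l (c₁l≈0 , c₂l≈0 , e)
      k : F
      k = proj₁ (invertible (c₃ l) c₃≉0)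
      k≉0 : ¬ k ≈ 0#
      k≉0 k≈0 = 1≉0 (trans (sym (proj₁ (proj₂ (invertible (c₃ l) c₃≉0)))) (trans (*-congʳ k≈0) (zeroˡ _)))
      null : ∀ {x} → x ≈ 0# → 0# ≈ k * x
      null x≈0 = sym (trans (*-congˡ x≈0) (zeroʳ k))
    s⁻¹ : F
    s⁻¹ = proj₁ (invertible s s≉0)

  -- Both lines are multiples of (ρ , τ , -γ), and s′ ≠ 0 because `l′` has a nonzero coordinate.
  -- This makes the zero of w + γ s along the pencil simple: only one line of the pencil satisfies
  -- it.
  pencil-same-line : ∀ d γ l l′ {s s′} → ¬ s ≈ 0# →
    c₁ l ≈ ρ d * s → c₂ l ≈ τ d * s → c₃ l + γ * s ≈ 0# →
    c₁ l′ ≈ ρ d * s′ → c₂ l′ ≈ τ d * s′ → c₃ l′ + γ * s′ ≈ 0# → l ∼ l′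
  pencil-same-line d γ l l′ {s} {s′} s≉0 e₁ e₂ e₃ e₁′ e₂′ e₃′ =
    s′ * s⁻¹ , k≉0 , ratio e₁ e₁′ , ratio e₂ e₂′ , ratio (solve-c₃ e₃) (solve-c₃ e₃′)
    where
    s⁻¹ : F
    s⁻¹ = proj₁ (invertible s s≉0)
    s⁻¹s≈1 : s⁻¹ * s ≈ 1#
    s⁻¹s≈1 = proj₁ (proj₂ (invertible s s≉0))
    solve-c₃ : ∀ {w s} → w + γ * s ≈ 0# → w ≈ - γ * s
    solve-c₃ e = trans (+-inverseˡ-unique _ _ e) (-‿distribˡ-* γ _)
    ratio : ∀ {x y z} → y ≈ x * s → z ≈ x * s′ → z ≈ s′ * s⁻¹ * y
    ratio {x} {y} {z} y≈ z≈ = begin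
      z                     ≈⟨ trans z≈ (sym (*-identityʳ _)) ⟩
      x * s′ * 1#           ≈⟨ *-congˡ s⁻¹s≈1 ⟨
      x * s′ * (s⁻¹ * s)    ≈⟨ S.solve 4 (λ x s′ i s → x S.:* s′ S.:* (i S.:* s) S.:= s′ S.:* i S.:* (x S.:* s))
           refl x s′ s⁻¹ s ⟩
      s′ * s⁻¹ * (x * s)    ≈⟨ *-congˡ y≈ ⟨
      s′ * s⁻¹ * y          ∎
    k≉0 : ¬ s′ * s⁻¹ ≈ 0#
    k≉0 k≈0 = nonzero l′ (null (ratio e₁ e₁′) , null (ratio e₂ e₂′) , null (ratio (solve-c₃ e₃) (solve-c₃ e₃′)))
      where
      null : ∀ {y z} → z ≈ s′ * s⁻¹ * y → z ≈ 0#
      null e = trans e (trans (*-congʳ k≈0) (zeroˡ _))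

-- From integer congruences to natural residues.

-- With `c` and `m` replaced by their residues, both sides are natural numbers and the congruence
-- can be read in 𝔽 as an equation between multiples of 1.
mod-residues : ∀ p .{{_ : NonZero p}} c m μ t → c ℤ.* + μ ≡ + t ℤ.- m [mod p ] →
  + t ≡ + ((m %ℕ p) ℕ.+ (c %ℕ p) ℕ.* μ) [mod p ]
mod-residues p c m μ t p∣ = Signed.∣⇒∣ᵤ (≡.subst (+ p Signed.∣_) (≡.sym rewritten)
  (Signed.∣m∣n⇒∣m+n (Signed.∣m∣n⇒∣m+n (Signed.∣m⇒∣-m (Signed.∣ᵤ⇒∣ {i = c ℤ.* + μ ℤ.- (+ t ℤ.- m)} p∣))
      (Signed.∣n⇒∣m*n (c′ ℤ.* + μ) Signed.∣-refl))
                    (Signed.∣n⇒∣m*n m′ Signed.∣-refl)))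
  where
  c₀ m₀ : ℕ
  c₀ = c %ℕ p
  m₀ = m %ℕ p
  c′ m′ : ℤ
  c′ = c /ℕ p
  m′ = m /ℕ p
  ring-identity : ∀ c₀ m₀ c′ m′ μ t p → t ℤ.- (m₀ ℤ.+ c₀ ℤ.* μ) ≡
    ℤ.- ((c₀ ℤ.+ c′ ℤ.* p) ℤ.* μ ℤ.- (t ℤ.- (m₀ ℤ.+ m′ ℤ.* p))) ℤ.+ c′ ℤ.* μ ℤ.* p ℤ.+ m′ ℤ.* p
  ring-identity = ℤ-RingSolver.solve-∀
  rewritten : + t ℤ.- + (m₀ ℕ.+ c₀ ℕ.* μ) ≡ ℤ.- (c ℤ.* + μ ℤ.- (+ t ℤ.- m)) ℤ.+ c′ ℤ.* + μ ℤ.* + p ℤ.+ m′ ℤ.* + p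
  rewritten = ≡.trans (≡.cong (λ x → + t ℤ.- (+ m₀ ℤ.+ x)) (ℤ.pos-* c₀ μ))
    (≡.trans (ring-identity (+ c₀) (+ m₀) c′ m′ (+ μ) (+ t) (+ p))
      (≡.cong₂ (λ x y → ℤ.- (x ℤ.* + μ ℤ.- (+ t ℤ.- y)) ℤ.+ c′ ℤ.* + μ ℤ.* + p ℤ.+ m′ ℤ.* + p)
        (≡.sym (a≡a%ℕn+[a/ℕn]*n c p)) (≡.sym (a≡a%ℕn+[a/ℕn]*n m p))))

mod-residue : ∀ p .{{_ : NonZero p}} m t → + t ≡ m [mod p ] → + t ≡ + (m %ℕ p) [mod p ]
mod-residue p m t p∣ = Signed.∣⇒∣ᵤ (≡.subst (+ p Signed.∣_) (≡.sym rewritten)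
  (Signed.∣m∣n⇒∣m+n (Signed.∣ᵤ⇒∣ {i = + t ℤ.- m} p∣) (Signed.∣n⇒∣m*n (m /ℕ p) Signed.∣-refl)))
  where
  ring-identity : ∀ t m₀ m′p → t ℤ.- m₀ ≡ t ℤ.- (m₀ ℤ.+ m′p) ℤ.+ m′p
  ring-identity = ℤ-RingSolver.solve-∀
  rewritten : + t ℤ.- + (m %ℕ p) ≡ + t ℤ.- m ℤ.+ (m /ℕ p) ℤ.* + p
  rewritten = ≡.trans (ring-identity (+ t) (+ (m %ℕ p)) ((m /ℕ p) ℤ.* + p))
    (≡.cong (λ x → + t ℤ.- x ℤ.+ (m /ℕ p) ℤ.* + p) (≡.sym (a≡a%ℕn+[a/ℕn]*n m p)))

∣-residue : ∀ p .{{_ : NonZero p}} c → p ℕ.∣ c %ℕ p → + p ∣ c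
∣-residue p c p∣c₀ = Signed.∣⇒∣ᵤ (≡.subst (+ p Signed.∣_) (≡.sym (a≡a%ℕn+[a/ℕn]*n c p))
  (Signed.∣m∣n⇒∣m+n (Signed.∣ᵤ⇒∣ {i = + (c %ℕ p)} p∣c₀) (Signed.∣n⇒∣m*n (c /ℕ p) Signed.∣-refl)))

-- The envelope and its intersection with each pencil.

module Envelope {a ℓ : Level} (p h q : ℕ) (p-prime : Prime p) (q≡p^h : q ≡ p ℕ.^ h) (𝔽 : FiniteField a ℓ q)
  (T : Plane.Multiset 𝔽) (c : ℤ) (p∤c : ¬ (+ p ∣ c)) where
  open FiniteField 𝔽 hiding (zero) renaming (Carrier to F)
  open Plane 𝔽
  open Homogeneous
  open Polynomials 𝔽
  open FiniteFieldSums 𝔽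
  open WeightedSums 𝔽
  open PrimeCharacteristic 𝔽 p p-prime (characteristic p h q≡p^h)
  open Pencils 𝔽
  open ElementarySymmetric commutativeSemiring
  open Newton commutativeRing
  open Mult semiring renaming (_×_ to _·_)
  open SetoidReasoning setoid
  private module Values = Extension 𝔽 commutativeSemiring (λ x → x)
            (Identity.isSemiringHomomorphism (Semiring.rawSemiring semiring) refl)
  private module Polys where
    open CommutativeSemiring polySemiring public using (_≈_; rawSemiring)
    open ElementarySymmetric polySemiring public using (product-of)
  private module Restrictions = Extension 𝔽 polySemiring constant constant-isSemiringHomomorphism

  instance
    p-nonZero : NonZero p
    p-nonZero = prime⇒nonZero p-prime

  c₀ : ℕ
  c₀ = c %ℕ p

  c₀-invertible : ∃ λ k → k · 1# * c₀ · 1# ≈ 1#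
  c₀-invertible = ·-invertible (λ p∣c₀ → p∤c (∣-residue p c p∣c₀))

  c⁻¹ : ℕ
  c⁻¹ = proj₁ c₀-invertible

  T/c : Multiset
  T/c = repeat c⁻¹ T

  Λ : ℕ
  Λ = length T/c % p

  g : Form Λ
  g i j = e-form T/c (toℕ i) (toℕ j)

  g-nonzero : NonzeroForm g
  -- The coefficient of W^Λ is e_0 = 1.
  g-nonzero = zero , zero , 1≉0

  Λ≡length-mod-p : Λ · 1# ≈ length T/c · 1#
  Λ≡length-mod-p = sym (trans (reflexive (≡.cong (_· 1#) (m≡m%n+[m/n]*n (length T/c) p))) (·-mod Λ (length T/c / p)))

  module AtDirection (d : Direction) (m : ℤ) {n : ℕ} (ren : Fin n → Line)
      (ren-enum : Enumerates ren (Renitent p T d m))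
    (μ : Fin n → ℕ) (μ-multiplicity : ∀ i → c ℤ.* + μ i ≡ + (# ren i ∩ T) ℤ.- m [mod p ])
    (μ-positive : ∀ i → 1 ≤ μ i) (μ-bound : sumℕ μ ≤ (q ∸ 2) ⊓ (p ∸ 1)) where

    α : Fin n → F
    α i = proj₁ (hasSlope-level d (ren i) (proj₁ (proj₁ ren-enum i)))

    level∼ren : ∀ i → level d (α i) ∼ ren i
    level∼ren i = proj₂ (hasSlope-level d (ren i) (proj₁ (proj₁ ren-enum i)))

    roots : List F
    roots = with-multiplicities α μ

    α-injective : ∀ {i j} → α i ≈ α j → i ≡ j
    α-injective {i} {j} e = proj₁ (proj₂ ren-enum)
      (∼-trans {ren i} {level d (α i)} {ren j} (∼-sym {level d (α i)} {ren i} (level∼ren i))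
        (∼-trans {level d (α i)} {level d (α j)} {ren j} (level-cong d e) (level∼ren j)))

    size : F → F
    size x = (# level d x ∩ T) · 1#

    size-at-α : ∀ {i x} → α i ≈ x → size x ≈ (m %ℕ p) · 1# + c₀ · 1# * μ i · 1#
    size-at-α {i} {x} αᵢ≈x = begin
      (# level d x ∩ T) · 1#
        ≡⟨ ≡.cong (_· 1#) (#-resp-∼ {level d x} {ren i}
             (∼-trans {level d x} {level d (α i)} {ren i} (level-cong d (sym αᵢ≈x)) (level∼ren i)) T) ⟩
      (# ren i ∩ T) · 1#
        ≈⟨ ·-congruent (# ren i ∩ T) (m %ℕ p ℕ.+ c₀ ℕ.* μ i)
            (mod-residues p c m (μ i) (# ren i ∩ T) (μ-multiplicity i)) ⟩
      (m %ℕ p ℕ.+ c₀ ℕ.* μ i) · 1#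
        ≈⟨ trans (×-homo-+ 1# (m %ℕ p) (c₀ ℕ.* μ i)) (+-congˡ (×1-homo-* c₀ (μ i))) ⟩
      (m %ℕ p) · 1# + c₀ · 1# * μ i · 1# ∎

    size-elsewhere : ∀ {x} → (∀ i → ¬ α i ≈ x) → size x ≈ (m %ℕ p) · 1#
    size-elsewhere {x} α≉x =
      -- A line with an atypical intersection number would be renitent and hence enumerated by
      -- `ren`; divisibility by p is decidable, so the refutation yields the congruence.
      ·-congruent t (m %ℕ p) (mod-residue p m t (decidable-stable (p ℕ.∣? ℤ.∣ + t ℤ.- m ∣) λ p∤ →
        let i , ren∼ = proj₂ (proj₂ ren-enum) (level d x) (level-hasSlope d x , p∤)
        in α≉x i (level-injective d (∼-trans {level d (α i)} {ren i} {level d x} (level∼ren i) ren∼))))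
      where t = # level d x ∩ T

    values : List F
    values = map (linear (ρ d) (τ d)) T/c

    -- Used with f = 1 for order 0 and with `power k` for the others. Each point counts c⁻¹ times,
    -- which cancels the factor `c₀` in the excess of every renitent line.
    same-sums : ∀ f → (∀ {x y} → x ≈ y → f x ≈ f y) → total f ≈ 0# → sum-over values f ≈ sum-over roots f
    same-sums f f-cong f≈0 = begin
      sum-over values f
        ≈⟨ sum-over-repeat (linear (ρ d) (τ d)) c⁻¹ T f ⟩
      c⁻¹ · 1# * sum-over (map (linear (ρ d) (τ d)) T) f
        ≈⟨ *-congˡ (sum-over-by-value (linear (ρ d) (τ d)) (λ x P → embed P ∈ₗ? level d x)
             (λ {x} {P} → ∈-level⇒ d P) (λ {x} {P} → ⇒∈-level d P) f f-cong T) ⟩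
      c⁻¹ · 1# * total (λ x → size x * f x)
        ≈⟨ *-congˡ (total-of-exceptions size α μ _ (c₀ · 1#) α-injective size-at-α size-elsewhere f f-cong f≈0) ⟩
      c⁻¹ · 1# * (c₀ · 1# * sum-over roots f)
        ≈⟨ trans (sym (*-assoc _ _ _)) (trans (*-congʳ (proj₂ c₀-invertible)) (*-identityˡ _)) ⟩
      sum-over roots f ∎

    1+sum<p : suc (sumℕ μ) ≤ p
    1+sum<p = ℕ.≤-trans (s≤s (ℕ.m≤n⊓o⇒m≤o (q ∸ 2) (p ∸ 1) μ-bound)) (ℕ.≤-reflexive (ℕ.suc-pred p))

    sum≡Λ : sumℕ μ ≡ Λ
    sum≡Λ = ·-injective 1+sum<p (m%n<n (length T/c) p) (begin
      sumℕ μ · 1#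
        ≡⟨ ≡.cong (_· 1#) (length-with-multiplicities α μ) ⟨
      length roots · 1#
        ≈⟨ sum-over-1 roots ⟨
      sum-over roots (λ _ → 1#)
        ≈⟨ same-sums (λ _ → 1#) (λ _ → refl) total-1 ⟨
      sum-over values (λ _ → 1#)
        ≈⟨ sum-over-1 values ⟩
      length values · 1#
        ≡⟨ ≡.cong (_· 1#) (length-map (linear (ρ d) (τ d)) T/c) ⟩
      length T/c · 1#
        ≈⟨ Λ≡length-mod-p ⟨
      Λ · 1# ∎)

    length-roots : length roots ≡ Λ
    length-roots = ≡.trans (length-with-multiplicities α μ) sum≡Λ

    same-e : ∀ {k} → k ≤ Λ → e values k ≈ e roots k
    same-e = power-sums-determine-e Λ values roots
      -- Here the two bounds on Λ act separately: Λ < p permits the cancellation, and Λ ≤ q - 2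
      -- makes the power sums vanish.
      (λ k<Λ → suc-·-cancel (ℕ.<-≤-trans (s≤s k<Λ) (≡.subst (λ s → suc s ≤ p) sum≡Λ 1+sum<p)))
      (λ {k} k<Λ → same-sums (power k) (power-cong k) (total-power k
        (3+k≤q q (ℕ.≤-trans k<Λ (ℕ.m≤n⊓o⇒m≤n (q ∸ 2) (p ∸ 1) (≡.subst (_≤ (q ∸ 2) ⊓ (p ∸ 1)) sum≡Λ μ-bound))))))
      where
      3+k≤q : ∀ {k} q → k < q ∸ 2 → 3 ℕ.+ k ≤ q
      -- For q below 2 the truncated difference is 0 and the hypothesis is absurd.
      3+k≤q (suc (suc q)) k<q = s≤s (s≤s k<q)

    module OnLine (i : Fin n) (l : Line) (ren∼l : ren i ∼ l) where
      private
        γ : F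
        γ = α i

        level∼l : level d γ ∼ l
        level∼l = ∼-trans {level d γ} {ren i} {l} (level∼ren i) ren∼l

        -- The factor of proportionality from (ρ d , τ d , -γ) to `l` is also the parameter of `l`
        -- in the pencil.
        s : F
        s = proj₁ level∼l

        s≉0 : ¬ s ≈ 0#
        s≉0 = proj₁ (proj₂ level∼l)

        c₁≈ : c₁ l ≈ ρ d * s
        c₁≈ = trans (proj₁ (proj₂ (proj₂ level∼l))) (*-comm _ _)

        c₂≈ : c₂ l ≈ τ d * s
        c₂≈ = trans (proj₁ (proj₂ (proj₂ (proj₂ level∼l)))) (*-comm _ _)

        on-l : c₃ l + γ * s ≈ 0#
        on-l = begin
          c₃ l + γ * s     ≈⟨ +-cong (proj₂ (proj₂ (proj₂ (proj₂ level∼l)))) (*-comm γ s) ⟩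
          s * - γ + s * γ  ≈⟨ distribˡ s (- γ) γ ⟨
          s * (- γ + γ)    ≈⟨ trans (*-congˡ (-‿inverseˡ γ)) (zeroʳ s) ⟩
          0#               ∎

      in-envelope : l ∈ₑ g
      in-envelope = begin
        Values.form-value Λ (e-form T/c) (c₁ l) (c₂ l) (c₃ l)
          ≈⟨ Values.form-value-factors T/c roots length-roots (ρ d) (τ d) {c₁ l} {c₂ l} s (c₃ l) c₁≈ c₂≈ same-e ⟩
        product-of (map (λ x → x) roots) s (c₃ l)
          ≡⟨ ≡.cong (λ L → product-of L s (c₃ l)) (map-id roots) ⟩
        product-of roots s (c₃ l)
          ≈⟨ vanishes α μ i (μ-positive i) on-l ⟩
        0# ∎
        where
        -- Since `μ i` is at least 1, the factor w + α_i s, which is zero, does occur in the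
        -- product.
        vanishes : ∀ {n} (α : Fin n → F) μ i → 1 ≤ μ i → ∀ {s w} → w + α i * s ≈ 0# →
          product-of (with-multiplicities α μ) s w ≈ 0#
        vanishes α μ zero    μ≥1 e with μ zero
        vanishes α μ zero    (s≤s _) e | suc _ = trans (*-congʳ e) (zeroˡ _)
        vanishes α μ (suc i) μ≥1 {s} {w} e = trans
          (product-of-++ (replicate (μ zero) (α zero)) (with-multiplicities (α ∘ suc) (μ ∘ suc)) s w)
          (trans (*-congˡ (vanishes (α ∘ suc) (μ ∘ suc) i μ≥1 e)) (zeroʳ _))

      pencil-multiplicity : PencilMultiplicity ⟨ d ⟩ g l (μ i)
      pencil-multiplicity = ∈-pencil d l c₁≈ c₂≈ , on-pencil
        where
        on-pencil : ∀ l′ → ⟨ d ⟩ ∈ₗ l′ → ¬ l ∼ l′ → HasOrderAt0 (restrict g l l′) (μ i)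
        on-pencil l′ ∈l′ l≁l′ = order-cong {restricted} {factored} same
          (≡.subst (HasOrderAt0 factored) (multiplicity α μ α-injective i)
            (order-product γ s s′ (c₃ l) (c₃ l′) s≉0 on-l
              -- If the coefficient of t in the factor belonging to γ were zero, `l′` would be the
              -- line `l` itself.
              (λ on-l′ → l≁l′ (pencil-same-line d γ l l′ s≉0 c₁≈ c₂≈ on-l c₁′≈ c₂′≈ on-l′)) roots))
          where
          s′ : F
          s′ = proj₁ (pencil-parameter d l′ ∈l′)
          c₁′≈ : c₁ l′ ≈ ρ d * s′
          c₁′≈ = proj₁ (proj₂ (pencil-parameter d l′ ∈l′))
          c₂′≈ : c₂ l′ ≈ τ d * s′
          c₂′≈ = proj₂ (proj₂ (pencil-parameter d l′ ∈l′))
          factored restricted : Poly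
          factored   = Polys.product-of (map constant roots) (s ∷ s′ ∷ []) (c₃ l ∷ c₃ l′ ∷ [])
          restricted = evalIn Polys.rawSemiring constant g
            (c₁ l ∷ c₁ l′ ∷ []) (c₂ l ∷ c₂ l′ ∷ []) (c₃ l ∷ c₃ l′ ∷ [])
          -- Along the pencil the first two coordinates are scalar multiples of the same polynomial
          -- s + s′ t, so the factorisation applies over 𝔽[t] with it in the role of `s`.
          on-line : ∀ r x x′ → x ≈ r * s → x′ ≈ r * s′ → (x ∷ x′ ∷ []) ≈ₚ constant r *ₚ (s ∷ s′ ∷ [])
          on-line r x x′ e e′ zero          = trans e (sym (+-identityʳ _))
          on-line r x x′ e e′ (suc zero)    = e′
          on-line r x x′ e e′ (suc (suc _)) = refl
          same : restricted Polys.≈ factored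
          same = Restrictions.form-value-factors T/c roots length-roots (ρ d) (τ d)
            {c₁ l ∷ c₁ l′ ∷ []} {c₂ l ∷ c₂ l′ ∷ []} (s ∷ s′ ∷ []) (c₃ l ∷ c₃ l′ ∷ [])
            (on-line (ρ d) (c₁ l) (c₁ l′) c₁≈ c₁′≈) (on-line (τ d) (c₂ l) (c₂ l′) c₂≈ c₂′≈) same-e

open import Data.Nat.Base using (_^_)

theorem2p4 : ∀ {a ℓ s : Level} (p h q : ℕ) → Prime p → q ≡ p ^ h →
    (𝔽 : FiniteField a ℓ q) → let open Plane 𝔽 in
    (T : Multiset) (lam : ℤ) (𝓕 : Pred Direction s)
    (m : Direction → ℤ) → (∀ d → d ∈ 𝓕 → IsTypical p T lam d (m d)) →
    (lam# : Direction → ℕ) → (∀ d → d ∈ 𝓕 → 0 < lam# d × + lam# d ℤ.≤ lam) →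
    (ren : ∀ d → Fin (lam# d) → Line) →
    (∀ d → d ∈ 𝓕 → Enumerates (ren d) (Renitent p T d (m d))) →
    (c : ℤ) → ¬ (+ p ∣ c) →
    (mult : ∀ d → Fin (lam# d) → ℕ) →
    (∀ d → d ∈ 𝓕 → ∀ i →
    1 ≤ mult d i × mult d i ≤ p ∸ 1 ×
    c ℤ.* + mult d i ≡ + (# ren d i ∩ T) ℤ.- m d [mod p ]) →
    (∀ d → d ∈ 𝓕 → sumℕ (mult d) ≤ (q ∸ 2) ⊓ (p ∸ 1)) →
    Σ ℕ λ Λ →
    (∀ d → d ∈ 𝓕 → sumℕ (mult d) ≡ Λ) ×
    Σ (Form Λ) λ g → NonzeroForm g ×
    (∀ d → d ∈ 𝓕 → ∀ i l → ren d i ∼ l →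
    l ∈ₑ g × PencilMultiplicity ⟨ d ⟩ g l (mult d i))
theorem2p4 p h q p-prime q≡p^h 𝔽 T _ 𝓕 m _ _ _ ren ren-enum c p∤c mult mult-spec mult-bound =
  Λ , (λ d d∈𝓕 → At.sum≡Λ d d∈𝓕) , g , g-nonzero ,
  λ d d∈𝓕 i l ren∼l → At.OnLine.in-envelope d d∈𝓕 i l ren∼l , At.OnLine.pencil-multiplicity d d∈𝓕 i l ren∼l
  where
  open Envelope p h q p-prime q≡p^h 𝔽 T c p∤c
  module At (d : Plane.Direction 𝔽) (d∈𝓕 : d ∈ 𝓕) = AtDirection d (m d) (ren d) (ren-enum d d∈𝓕) (mult d)
    (λ i → proj₂ (proj₂ (mult-spec d d∈𝓕 i))) (λ i → proj₁ (mult-spec d d∈𝓕 i)) (mult-bound d d∈𝓕)
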